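{- Let $0\le k\le d$ be integers and let $0<\alpha\le 1$ be a real number. There exists a constant $\beta=\beta(\alpha,k,d)>0$, depending only on $\alpha,k,d$, such that the following holds. For every finite family $\mathcal{F}$ of at least $d-k+1$ closed convex sets in $\mathbb{R}^d$, if at least $\alpha\binom{|\mathcal{F}|}{d-k+1}$ of the $(d-k+1)$-element subfamilies of $\mathcal{F}$ have the property that their intersection contains a $k$-flat, then there exists $\mathcal{G}\subseteq\mathcal{F}$ such that $|\mathcal{G}|\ge\beta|\mathcal{F}|$ and $\bigcap\mathcal{G}$ contains a $k$-flat. Moreover, $\beta$ can be chosen so that $\beta\ge\frac{\alpha}{d-k+1}$.
   Context: A $k$-flat in $\mathbb{R}^d$ is a $k$-dimensional affine subspace (a $0$-flat is a point). $\bigcap\mathcal{G}$ denotes the intersection of all sets in the family $\mathcal{G}$. -}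

module Defs where

open import Algebra.Bundles using (CommutativeRing)
open import Data.Fin.Base using (Fin)
open import Data.Fin.Subset as Subset using (Subset)
open import Data.List.Base using (List; length)
open import Data.List.Relation.Unary.All using (All)
open import Data.List.Relation.Unary.Unique.Propositional using (Unique)
open import Data.Nat.Base using (ℕ)
open import Data.Product.Base using (Σ-syntax; ∃-syntax; _×_)
open import Data.Vec.Functional using (Vector)
open import Level using (0ℓ; suc)
open import Relation.Binary.Core using (Rel)
open import Relation.Binary.Structures using (IsTotalOrder)
open import Relation.Nullary.Negation using (¬_)
open import Relation.Unary using (Pred; _∈_; _⊆_; ∁; Satisfiable)

import Algebra.Definitions.RawMonoid as RawMonoidDefinitions
import Relation.Binary.Construct.NonStrictToStrict as Strict

-- The real numbers, characterised up to isomorphism as a Dedekind-complete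
-- ordered field.  The inverse is total, as usual for fields in a classical
-- setting; its value at 0# is unspecified.

record RealField : Set (suc 0ℓ) where
  infix  4 _≤_
  infix  8 _⁻¹
  infixl 7 _÷_

  field
    commutativeRing : CommutativeRing 0ℓ 0ℓ

  open CommutativeRing commutativeRing public

  field
    _≤_          : Rel Carrier 0ℓ
    isTotalOrder : IsTotalOrder _≈_ _≤_
    _⁻¹          : Carrier → Carrier
    0≉1          : ¬ 0# ≈ 1#
    *-inverseʳ   : ∀ x → ¬ x ≈ 0# → x * x ⁻¹ ≈ 1#
    +-monoʳ-≤    : ∀ x {y z} → y ≤ z → x + y ≤ x + z
    *-nonNeg     : ∀ {x y} → 0# ≤ x → 0# ≤ y → 0# ≤ x * y

  UpperBound : Pred Carrier 0ℓ → Pred Carrier 0ℓ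
  UpperBound S b = ∀ {x} → x ∈ S → x ≤ b

  field
    complete : (S : Pred Carrier 0ℓ) → Satisfiable S → Satisfiable (UpperBound S) →
               ∃[ s ] (UpperBound S s × (∀ {b} → UpperBound S b → s ≤ b))

  open Strict _≈_ _≤_ public using (_<_)
  open RawMonoidDefinitions +-rawMonoid public using (sum)
  private module Multiple = RawMonoidDefinitions +-rawMonoid

  fromℕ : ℕ → Carrier
  fromℕ n = n Multiple.× 1#

  _÷_ : Carrier → Carrier → Carrier
  x ÷ y = x * y ⁻¹

module Euclidean (ℝ : RealField) where
  open RealField ℝ

  Point : ℕ → Set
  Point d = Vector Carrier d

  dist² : ∀ {d} → Point d → Point d → Carrier
  dist² x y = sum (λ j → (x j - y j) * (x j - y j))

  Open : ∀ {d} → Pred (Pred (Point d) 0ℓ) 0ℓ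
  Open {d} U = ∀ (x : Point d) → x ∈ U →
    ∃[ ε ] (0# < ε × (∀ (y : Point d) → dist² x y < ε * ε → y ∈ U))

  -- Classically, a closed set automatically respects the pointwise equality
  -- of points, since points at distance zero cannot be separated.

  Closed : ∀ {d} → Pred (Pred (Point d) 0ℓ) 0ℓ
  Closed C = Open (∁ C)

  Convex : ∀ {d} → Pred (Pred (Point d) 0ℓ) 0ℓ
  Convex {d} C = ∀ (x y : Point d) → x ∈ C → y ∈ C →
    ∀ t → 0# ≤ t → t ≤ 1# → (λ j → t * x j + (1# - t) * y j) ∈ C

  combination : ∀ {k d} → Vector Carrier k → Vector (Point d) k → Point d
  combination t v j = sum (λ i → t i * v i j)

  LinearlyIndependent : ∀ {k d} → Pred (Vector (Point d) k) 0ℓ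
  LinearlyIndependent {k} v = ∀ (t : Vector Carrier k) →
    (∀ j → combination t v j ≈ 0#) → ∀ i → t i ≈ 0#

  -- A k-dimensional affine subspace, presented by one of its points and a
  -- basis of its direction space.

  record Flat (k d : ℕ) : Set where
    field
      base        : Point d
      direction   : Vector (Point d) k
      independent : LinearlyIndependent direction

    points : Pred (Point d) 0ℓ
    points x = Σ[ t ∈ Vector Carrier k ] (∀ j → x j ≈ base j + combination t direction j)

  ContainsFlat : ∀ {d} → ℕ → Pred (Pred (Point d) 0ℓ) 0ℓ
  ContainsFlat {d} k X = Σ[ E ∈ Flat k d ] Flat.points E ⊆ X

  -- Subfamilies of a family indexed by Fin n are subsets of Fin n, so that
  -- members are counted with multiplicity; families without repetition are
  -- the case of pairwise distinct F i.

  ⋂ : ∀ {n d} → (Fin n → Pred (Point d) 0ℓ) → Subset n → Pred (Point d) 0ℓ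
  ⋂ F G x = ∀ {i} → i Subset.∈ G → x ∈ F i

  -- At least r elements satisfy P (which need not be decidable).

  AtLeast : {A : Set} → Carrier → Pred A 0ℓ → Set
  AtLeast {A} r P = Σ[ xs ∈ List A ] (Unique xs × All P xs × r ≤ fromℕ (length xs))

{-# OPTIONS --safe #-}
module Submission where

-- Put m = d - k.  If ⋂ T contains a k-flat, let x be its point of least norm
-- and L its lineality space, so that x + L ⊆ ⋂ T and dim L ≥ k.  A
-- subfamily of T minimal with the property that x is still nearest consists of
-- at most codim L′ sets, L′ being its lineality space, by Radon's argument.
-- Adding sets that shrink L′ increases the codimension each time, until L′ = L.
-- Thus x and L are determined by at most codim L ≤ m, hence by exactly m,
-- members of T.  By pigeonhole some m sets S determine x + L for at least
-- α C(n, m+1) / C(n, m) of the good (m+1)-families T ⊇ S, and x + L lies in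
-- all their members.

-- The obstacle is that a k-flat in ⋂ T is far from unique, while the pigeonhole step needs one that
-- S alone fixes. The nearest point to the origin removes the choice, since it is unique in a closed
-- convex set. The k directions found in different T may still differ, but all of them lie in the
-- lineality space that S fixes, whose dimension may exceed k. In a subfamily minimal for x, each
-- set can be blamed for a point strictly closer to the origin that lies in all the other sets. If
-- the offsets of these points from x were dependent modulo L′, splitting the coefficients by sign
-- would give a closer point common to all sets. Dimension itself is never defined: vectors
-- independent modulo a subspace bound its codimension from below. The constant: at least α C(n,
-- m+1) / C(n, m) = α (n - m) / (m + 1) families T share one S. Each adds a member of its own to the
-- m sets of S, and m + α (n - m) / (m + 1) ≥ α n / (m + 1) because α ≤ 1.

open import Algebra.Bundles using (CommutativeRing)
open import Axiom.ExcludedMiddle using (ExcludedMiddle)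
open import Data.Fin.Base using (Fin; zero; suc; punchIn)
open import Data.Fin.Subset as Subset using (Subset; ∣_∣)
open import Data.List.Base using (List; []; _∷_; length)
open import Data.List.Relation.Unary.All as All using (All; []; _∷_)
open import Data.List.Relation.Unary.Unique.Propositional using (Unique)
open import Data.Nat.Base as ℕ using (ℕ; zero; suc; _∸_)
import Data.Nat.Properties as ℕ
open import Data.Product.Base using (_×_; _,_; proj₁; proj₂; ∃-syntax; Σ-syntax)
open import Data.Sum.Base using (_⊎_; inj₁; inj₂; swap)
open import Data.Vec.Functional as Vector using (Vector)
open import Defs
open import Function.Base using (_∘_)
open import Level using (0ℓ)
open import Relation.Binary.PropositionalEquality.Core as ≡ using (_≡_; _≢_)
open import Relation.Nullary.Decidable using (yes; no; decidable-stable)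
open import Relation.Nullary.Negation using (¬_; contradiction)
open import Relation.Unary using (Pred)

-- A ring solver with integer coefficients.

module IntegerCoefficients {c ℓ} (R : CommutativeRing c ℓ) where

  import Algebra.Properties.Ring as RingProperties
  import Algebra.Properties.Semiring.Mult.TCOptimised as Mult′
  import Algebra.Solver.Ring as RingSolver
  open import Algebra.Solver.Ring.AlmostCommutativeRing using (fromCommutativeRing; _-Raw-AlmostCommutative⟶_)
  open import Data.Integer.Base as ℤ using (ℤ; +_; -[1+_])
  import Data.Integer.Properties as ℤ
  open import Data.Maybe.Base using (Maybe; map)
  open import Relation.Binary.Consequences using (dec⇒weaklyDec)

  open CommutativeRing R hiding (zero)
  open RingProperties ring
  open Mult′ semiring renaming (_×_ to _·_)
  open import Relation.Binary.Reasoning.Setoid setoid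

  -- The type-checking optimised multiples send 1 to `1#` and 2 to `1# + 1#` by reduction, so that
  -- solver constants match the terms in the goals. Integers serve as coefficients because their
  -- equality is decidable.
  ⟦_⟧ : ℤ → Carrier
  ⟦ + n ⟧      = n · 1#
  ⟦ -[1+ n ] ⟧ = - (suc n · 1#)

  suc-· : ∀ n → suc n · 1# ≈ 1# + n · 1#
  suc-· n = ×-homo-+ 1# 1 n

  ⊖-homo : ∀ m n → ⟦ m ℤ.⊖ n ⟧ ≈ m · 1# - n · 1#
  ⊖-homo zero zero = sym (-‿inverseʳ 0#)
  ⊖-homo zero (suc n) = sym (+-identityˡ _)
  ⊖-homo (suc m) zero = sym (trans (+-congˡ -0#≈0#) (+-identityʳ _))
  ⊖-homo (suc m) (suc n) = begin
    ⟦ suc m ℤ.⊖ suc n ⟧                 ≡⟨ ≡.cong ⟦_⟧ (ℤ.[1+m]⊖[1+n]≡m⊖n m n) ⟩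
    ⟦ m ℤ.⊖ n ⟧                         ≈⟨ ⊖-homo m n ⟩
    m · 1# - n · 1#                     ≈⟨ +-congʳ (+-identityˡ _) ⟨
    0# + m · 1# - n · 1#                ≈⟨ +-congʳ (+-congʳ (-‿inverseʳ 1#)) ⟨
    1# - 1# + m · 1# - n · 1#           ≈⟨ +-congʳ (+-assoc _ _ _) ⟩
    1# + (- 1# + m · 1#) - n · 1#       ≈⟨ +-congʳ (+-congˡ (+-comm _ _)) ⟩
    1# + (m · 1# - 1#) - n · 1#         ≈⟨ +-congʳ (+-assoc _ _ _) ⟨
    1# + m · 1# - 1# - n · 1#           ≈⟨ +-assoc _ _ _ ⟩
    1# + m · 1# + (- 1# - n · 1#)       ≈⟨ +-cong (suc-· m) (sym (-‿+-comm _ _)) ⟨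
    suc m · 1# + - (1# + n · 1#)         ≈⟨ +-congˡ (-‿cong (suc-· n)) ⟨
    suc m · 1# - suc n · 1#             ∎

  ⊖-homo′ : ∀ m n → ⟦ n ℤ.⊖ m ⟧ ≈ - (m · 1#) + n · 1#
  ⊖-homo′ m n = trans (⊖-homo n m) (+-comm _ _)

  +-homo : ∀ i j → ⟦ i ℤ.+ j ⟧ ≈ ⟦ i ⟧ + ⟦ j ⟧
  +-homo (+ m)    (+ n)    = ×-homo-+ 1# m n
  +-homo (+ m)    -[1+ n ] = ⊖-homo m (suc n)
  +-homo -[1+ m ] (+ n)    = ⊖-homo′ (suc m) n
  +-homo -[1+ m ] -[1+ n ] = trans
    (-‿cong (trans (reflexive (≡.cong (λ h → suc h · 1#) (≡.sym (ℕ.+-suc m n)))) (×-homo-+ 1# (suc m) (suc n))))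
    (sym (-‿+-comm _ _))

  -‿homo : ∀ i → ⟦ ℤ.- i ⟧ ≈ - ⟦ i ⟧
  -‿homo (+ zero)  = sym -0#≈0#
  -‿homo (+ suc n) = refl
  -‿homo -[1+ n ]  = sym (-‿involutive _)

  +*-homo : ∀ m j → ⟦ + m ℤ.* j ⟧ ≈ m · 1# * ⟦ j ⟧
  +*-homo zero j = trans (reflexive (≡.cong ⟦_⟧ (ℤ.*-zeroˡ j))) (sym (zeroˡ _))
  +*-homo (suc m) j = begin
    ⟦ + suc m ℤ.* j ⟧               ≡⟨ ≡.cong ⟦_⟧ (ℤ.*-distribʳ-+ j (+ 1) (+ m)) ⟩
    ⟦ + 1 ℤ.* j ℤ.+ + m ℤ.* j ⟧     ≡⟨ ≡.cong (λ h → ⟦ h ℤ.+ + m ℤ.* j ⟧) (ℤ.*-identityˡ j) ⟩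
    ⟦ j ℤ.+ + m ℤ.* j ⟧             ≈⟨ +-homo j (+ m ℤ.* j) ⟩
    ⟦ j ⟧ + ⟦ + m ℤ.* j ⟧           ≈⟨ +-cong (sym (*-identityˡ _)) (+*-homo m j) ⟩
    1# * ⟦ j ⟧ + m · 1# * ⟦ j ⟧     ≈⟨ distribʳ _ _ _ ⟨
    (1# + m · 1#) * ⟦ j ⟧           ≈⟨ *-congʳ (suc-· m) ⟨
    suc m · 1# * ⟦ j ⟧              ∎

  *-homo : ∀ i j → ⟦ i ℤ.* j ⟧ ≈ ⟦ i ⟧ * ⟦ j ⟧
  *-homo (+ m)    j = +*-homo m j
  *-homo -[1+ m ] j = begin
    ⟦ -[1+ m ] ℤ.* j ⟧        ≡⟨ ≡.cong ⟦_⟧ (ℤ.neg-distribˡ-* (+ suc m) j) ⟨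
    ⟦ ℤ.- (+ suc m ℤ.* j) ⟧   ≈⟨ -‿homo (+ suc m ℤ.* j) ⟩
    - ⟦ + suc m ℤ.* j ⟧       ≈⟨ -‿cong (+*-homo (suc m) j) ⟩
    - (suc m · 1# * ⟦ j ⟧)    ≈⟨ -‿distribˡ-* _ _ ⟩
    - (suc m · 1#) * ⟦ j ⟧    ∎

  morphism : ℤ.+-*-rawRing -Raw-AlmostCommutative⟶ fromCommutativeRing R
  morphism = record
    { ⟦_⟧ = ⟦_⟧ ; +-homo = +-homo ; *-homo = *-homo ; -‿homo = -‿homo
    ; 0-homo = refl ; 1-homo = refl }

  ≟-weak : ∀ i j → Maybe (⟦ i ⟧ ≈ ⟦ j ⟧)
  ≟-weak i j = map (reflexive ∘ ≡.cong ⟦_⟧) (dec⇒weaklyDec ℤ._≟_ i j)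

  module Solver = RingSolver ℤ.+-*-rawRing (fromCommutativeRing R) morphism ≟-weak

-- Arithmetic and finite sums in the ordered field.

module OrderedField (em : ExcludedMiddle 0ℓ) (ℝ : RealField) where

  import Algebra.Properties.Semiring.Mult as Mult
  import Algebra.Properties.Semiring.Sum as Sum
  open import Data.Integer.Base using (+_)
  open import Relation.Binary.Bundles using (Poset)
  import Relation.Binary.Reasoning.PartialOrder as PosetReasoning
  import Relation.Binary.Reasoning.Setoid as SetoidReasoning
  open import Relation.Binary.Structures using (IsTotalOrder)

  open RealField ℝ hiding (zero)
  open Mult semiring using (×-homo-+; ×1-homo-*)
  open Sum semiring using (sum-cong-≋; sum-replicate-zero; ∑-distrib-+; *-distribˡ-sum)
  open IntegerCoefficients commutativeRing using (module Solver)
  open Solver using (solve; con; _:=_; _:+_; _:*_; _:-_; :-_) public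

  poset : Poset 0ℓ 0ℓ 0ℓ
  poset = record { isPartialOrder = IsTotalOrder.isPartialOrder isTotalOrder }

  module ≤-Reasoning = PosetReasoning poset
  module ≈-Reasoning = SetoidReasoning setoid

  open IsTotalOrder isTotalOrder public using (total; ≤-respˡ-≈; ≤-respʳ-≈) renaming
    (refl to ≤-refl; reflexive to ≤-reflexive; trans to ≤-trans; antisym to ≤-antisym)

  private variable
    x y z w : Carrier
    n : ℕ

  by-contradiction : {P : Set} → (¬ ¬ P) → P
  by-contradiction = decidable-stable em

  ≰⇒> : ¬ x ≤ y → y < x
  ≰⇒> {x} {y} x≰y with total x y
  ... | inj₁ x≤y = contradiction x≤y x≰y
  ... | inj₂ y≤x = y≤x , x≰y ∘ ≤-reflexive ∘ sym

  <⇒≱ : x < y → ¬ y ≤ x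
  <⇒≱ (x≤y , x≉y) y≤x = x≉y (≤-antisym x≤y y≤x)

  ≮⇒≥ : ¬ x < y → y ≤ x
  ≮⇒≥ x≮y = by-contradiction (x≮y ∘ ≰⇒>)

  <⇒≤ : x < y → x ≤ y
  <⇒≤ = proj₁

  <-≤-trans : x < y → y ≤ z → x < z
  <-≤-trans x<y y≤z = ≰⇒> λ z≤x → <⇒≱ x<y (≤-trans y≤z z≤x)

  ≤-<-trans : x ≤ y → y < z → x < z
  ≤-<-trans x≤y y<z = ≰⇒> λ z≤x → <⇒≱ y<z (≤-trans z≤x x≤y)

  >⇒≉ : 0# < x → ¬ x ≈ 0#
  >⇒≉ 0<x x≈0 = proj₂ 0<x (sym x≈0)

  ≤⇒0≤- : x ≤ y → 0# ≤ y - x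
  ≤⇒0≤- {x} {y} x≤y = begin
    0#        ≈⟨ -‿inverseˡ x ⟨
    - x + x   ≤⟨ +-monoʳ-≤ (- x) x≤y ⟩
    - x + y   ≈⟨ +-comm _ _ ⟩
    y - x     ∎
    where open ≤-Reasoning

  -- Many inequalities below are certificates of this form: the slack `e` is written as a visibly
  -- nonnegative expression, and a ring identity is left to the solver.
  ≤-by : ∀ e → 0# ≤ e → y ≈ x + e → x ≤ y
  ≤-by {y} {x} e 0≤e y≈x+e = begin
    x        ≈⟨ +-identityʳ x ⟨
    x + 0#   ≤⟨ +-monoʳ-≤ x 0≤e ⟩
    x + e    ≈⟨ y≈x+e ⟨
    y        ∎
    where open ≤-Reasoning

  0≤-⇒≤ : 0# ≤ y - x → x ≤ y
  0≤-⇒≤ {y} {x} 0≤ = ≤-by (y - x) 0≤ (solve 2 (λ x y → y := x :+ (y :- x)) refl x y)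

  +-mono-≤ : x ≤ y → z ≤ w → x + z ≤ y + w
  +-mono-≤ {x} {y} {z} {w} x≤y z≤w = ≤-trans (+-monoʳ-≤ x z≤w)
    (≤-respˡ-≈ (+-comm w x) (≤-respʳ-≈ (+-comm w y) (+-monoʳ-≤ w x≤y)))

  +-nonNeg : 0# ≤ x → 0# ≤ y → 0# ≤ x + y
  +-nonNeg 0≤x 0≤y = ≤-respˡ-≈ (+-identityˡ 0#) (+-mono-≤ 0≤x 0≤y)

  <⇒0<- : x < y → 0# < y - x
  <⇒0<- x<y = ≰⇒> λ y-x≤0 → <⇒≱ x<y (0≤-⇒≤ (≤-by _ (≤⇒0≤- y-x≤0)
    (solve 2 (λ x y → x :- y := con (+ 0) :+ (con (+ 0) :- (y :- x))) refl _ _)))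

  0<-⇒< : 0# < y - x → x < y
  0<-⇒< 0<y-x = ≰⇒> λ y≤x → <⇒≱ 0<y-x (≤-by _ (≤⇒0≤- y≤x)
    (solve 2 (λ x y → con (+ 0) := (y :- x) :+ (x :- y)) refl _ _))

  sq-nonNeg : ∀ x → 0# ≤ x * x
  sq-nonNeg x with total 0# x
  ... | inj₁ 0≤x = *-nonNeg 0≤x 0≤x
  ... | inj₂ x≤0 = ≤-respʳ-≈ (solve 1 (λ x → (con (+ 0) :- x) :* (con (+ 0) :- x) := x :* x) refl x)
                     (*-nonNeg (≤⇒0≤- x≤0) (≤⇒0≤- x≤0))

  0≤1 : 0# ≤ 1#
  0≤1 = ≤-respʳ-≈ (*-identityʳ 1#) (sq-nonNeg 1#)

  0<1 : 0# < 1#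
  0<1 = 0≤1 , 0≉1

  *-monoˡ-≤ : 0# ≤ x → y ≤ z → x * y ≤ x * z
  *-monoˡ-≤ {x} {y} {z} 0≤x y≤z = ≤-by _ (*-nonNeg 0≤x (≤⇒0≤- y≤z))
    (solve 3 (λ x y z → x :* z := x :* y :+ x :* (z :- y)) refl x y z)

  ⁻¹-cancelˡ : ¬ x ≈ 0# → ∀ y → x ⁻¹ * (x * y) ≈ y
  ⁻¹-cancelˡ {x} x≉0 y = begin
    x ⁻¹ * (x * y)   ≈⟨ solve 3 (λ x y z → z :* (x :* y) := (x :* z) :* y) refl x y (x ⁻¹) ⟩
    (x * x ⁻¹) * y   ≈⟨ *-congʳ (*-inverseʳ x x≉0) ⟩
    1# * y           ≈⟨ *-identityˡ y ⟩
    y                ∎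
    where open ≈-Reasoning

  *-÷ : ¬ x ≈ 0# → ∀ y → x * (x ⁻¹ * y) ≈ y
  *-÷ {x} x≉0 y = trans (solve 3 (λ x y z → x :* (z :* y) := z :* (x :* y)) refl x y (x ⁻¹)) (⁻¹-cancelˡ x≉0 y)

  *-cancelˡ : ¬ x ≈ 0# → x * y ≈ x * z → y ≈ z
  *-cancelˡ {x} {y} {z} x≉0 xy≈xz = trans (sym (⁻¹-cancelˡ x≉0 y)) (trans (*-congˡ xy≈xz) (⁻¹-cancelˡ x≉0 z))

  x*y≈0⇒y≈0 : ¬ x ≈ 0# → x * y ≈ 0# → y ≈ 0#
  x*y≈0⇒y≈0 x≉0 xy≈0 = *-cancelˡ x≉0 (trans xy≈0 (sym (zeroʳ _)))

  *-pos : 0# < x → 0# < y → 0# < x * y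
  *-pos 0<x 0<y = *-nonNeg (<⇒≤ 0<x) (<⇒≤ 0<y) , λ 0≈xy → >⇒≉ 0<y (x*y≈0⇒y≈0 (>⇒≉ 0<x) (sym 0≈xy))

  +-pos : 0# < x → 0# ≤ y → 0# < x + y
  +-pos 0<x 0≤y = <-≤-trans 0<x (≤-by _ 0≤y refl)

  ⁻¹-pos : 0# < x → 0# < x ⁻¹
  ⁻¹-pos {x} 0<x = ≰⇒> λ x⁻¹≤0 → <⇒≱ 0<1 (begin
    1#         ≈⟨ *-inverseʳ x (>⇒≉ 0<x) ⟨
    x * x ⁻¹   ≤⟨ *-monoˡ-≤ (<⇒≤ 0<x) x⁻¹≤0 ⟩
    x * 0#     ≈⟨ zeroʳ x ⟩
    0#         ∎)
    where open ≤-Reasoning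

  *-cancelˡ-≤ : 0# < x → x * y ≤ x * z → y ≤ z
  *-cancelˡ-≤ {x} {y} {z} 0<x xy≤xz = begin
    y                ≈⟨ ⁻¹-cancelˡ (>⇒≉ 0<x) y ⟨
    x ⁻¹ * (x * y)   ≤⟨ *-monoˡ-≤ (<⇒≤ (⁻¹-pos 0<x)) xy≤xz ⟩
    x ⁻¹ * (x * z)   ≈⟨ ⁻¹-cancelˡ (>⇒≉ 0<x) z ⟩
    z                ∎
    where open ≤-Reasoning

  sq-cancel-≤ : 0# ≤ y → x * x ≤ y * y → x ≤ y
  sq-cancel-≤ {y} {x} 0≤y xx≤yy = ≮⇒≥ λ y<x →
    <⇒≱ (*-pos (<⇒0<- y<x) (+-pos (<-≤-trans (≤-<-trans 0≤y y<x) ≤-refl) 0≤y))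
      (≤-by _ (≤⇒0≤- xx≤yy)
        (solve 2 (λ x y → con (+ 0) := (x :- y) :* (x :+ y) :+ (y :* y :- x :* x)) refl x y))

  -- The two hypotheses bound the absolute value of `x` by `y`; the slack is (y - x)(y + x).
  sq-mono-≤ : 0# ≤ y - x → 0# ≤ y + x → x * x ≤ y * y
  sq-mono-≤ {y} {x} 0≤y-x 0≤y+x = ≤-by _ (*-nonNeg 0≤y-x 0≤y+x)
    (solve 2 (λ x y → y :* y := x :* x :+ (y :- x) :* (y :+ x)) refl x y)

  sq≈0⇒≈0 : x * x ≈ 0# → x ≈ 0#
  sq≈0⇒≈0 {x} xx≈0 = by-contradiction λ x≉0 → x≉0 (x*y≈0⇒y≈0 x≉0 xx≈0)

  sum-mono-≤ : {f g : Vector Carrier n} → (∀ i → f i ≤ g i) → sum f ≤ sum g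
  sum-mono-≤ {zero}  f≤g = ≤-refl
  sum-mono-≤ {suc n} f≤g = +-mono-≤ (f≤g zero) (sum-mono-≤ (f≤g ∘ suc))

  sum-nonNeg : {f : Vector Carrier n} → (∀ i → 0# ≤ f i) → 0# ≤ sum f
  sum-nonNeg {n} 0≤f = ≤-respˡ-≈ (sum-replicate-zero n) (sum-mono-≤ 0≤f)

  sum≈0⇒≈0 : {f : Vector Carrier n} → (∀ i → 0# ≤ f i) → sum f ≈ 0# → ∀ i → f i ≈ 0#
  sum≈0⇒≈0 {f = f} 0≤f ∑f≈0 zero =
    ≤-antisym (≤-respʳ-≈ ∑f≈0 (≤-by _ (sum-nonNeg (0≤f ∘ suc)) refl)) (0≤f zero)
  sum≈0⇒≈0 {f = f} 0≤f ∑f≈0 (suc i) = sum≈0⇒≈0 (0≤f ∘ suc) ∑′≈0 i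
    where
    ∑′≈0 = ≤-antisym (≤-respʳ-≈ ∑f≈0 (≤-by _ (0≤f zero) (+-comm _ _))) (sum-nonNeg (0≤f ∘ suc))

  sum-const : ∀ n x → sum (λ (_ : Fin n) → x) ≈ fromℕ n * x
  sum-const zero x = sym (zeroˡ x)
  sum-const (suc n) x = begin
    x + sum (λ (_ : Fin n) → x)   ≈⟨ +-cong (sym (*-identityˡ x)) (sum-const n x) ⟩
    1# * x + fromℕ n * x          ≈⟨ distribʳ x 1# (fromℕ n) ⟨
    (1# + fromℕ n) * x            ∎
    where open ≈-Reasoning

  sum-+ : (f g : Vector Carrier n) → sum (λ i → f i + g i) ≈ sum f + sum g
  sum-+ = ∑-distrib-+

  sum-* : ∀ x (f : Vector Carrier n) → sum (λ i → x * f i) ≈ x * sum f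
  sum-* x f = sym (*-distribˡ-sum x f)

  sum-cong : {f g : Vector Carrier n} → (∀ i → f i ≈ g i) → sum f ≈ sum g
  sum-cong = sum-cong-≋

  sum-0 : {f : Vector Carrier n} → (∀ i → f i ≈ 0#) → sum f ≈ 0#
  sum-0 {n} f≈0 = trans (sum-cong f≈0) (sum-replicate-zero n)

  fromℕ-nonNeg : ∀ n → 0# ≤ fromℕ n
  fromℕ-nonNeg zero    = ≤-refl
  fromℕ-nonNeg (suc n) = +-nonNeg 0≤1 (fromℕ-nonNeg n)

  fromℕ-pos : ∀ n → 0# < fromℕ (suc n)
  fromℕ-pos n = +-pos 0<1 (fromℕ-nonNeg n)

  fromℕ-+ : ∀ m n → fromℕ (m ℕ.+ n) ≈ fromℕ m + fromℕ n
  fromℕ-+ = ×-homo-+ 1#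

  fromℕ-* : ∀ m n → fromℕ (m ℕ.* n) ≈ fromℕ m * fromℕ n
  fromℕ-* = ×1-homo-*

  fromℕ-mono-≤ : ∀ {m n} → m ℕ.≤ n → fromℕ m ≤ fromℕ n
  fromℕ-mono-≤ {m} {n} m≤n = ≤-by _ (fromℕ-nonNeg (n ℕ.∸ m))
    (trans (reflexive (≡.cong fromℕ (≡.sym (ℕ.m+[n∸m]≡n m≤n)))) (fromℕ-+ m (n ℕ.∸ m)))

-- Linear independence, also modulo a subspace.

module LinearAlgebra (em : ExcludedMiddle 0ℓ) (ℝ : RealField) where

  import Algebra.Properties.Semiring.Sum as Sum
  open import Data.Fin.Base using (_↑ˡ_; _↑ʳ_; splitAt)
  open import Data.Fin.Properties using (splitAt⁻¹-↑ˡ; splitAt⁻¹-↑ʳ)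
  open import Data.Integer.Base using (+_)
  open import Data.Vec.Functional using (insertAt; removeAt; _++_)
  open import Data.Vec.Functional.Properties using (insertAt-lookup; insertAt-punchIn; lookup-++ˡ; lookup-++ʳ)
  open import Relation.Unary using (_∈_; _⊆_)

  open OrderedField em ℝ
  open RealField ℝ hiding (zero)
  open Euclidean ℝ
  open Sum semiring using (sum-remove)
  open ≈-Reasoning

  private variable
    d k s : ℕ

  independent⇒≤ : ∀ {d k} (v : Vector (Point d) k) → LinearlyIndependent v → k ℕ.≤ d
  independent⇒≤ {d}     {zero}  v indep = ℕ.z≤n
  independent⇒≤ {zero}  {suc k} v indep = contradiction (sym (indep (λ _ → 1#) (λ ()) zero)) 0≉1
  independent⇒≤ {suc d} {suc k} v indep with em {∃[ i ] ¬ v i zero ≈ 0#}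
  ... | no ∄pivot = ℕ.m≤n⇒m≤1+n (independent⇒≤ (λ i → v i ∘ suc) λ t tv≈0 → indep t λ where
    zero    → sum-0 λ i → trans (*-congˡ (by-contradiction (∄pivot ∘ (i ,_)))) (zeroʳ (t i))
    (suc j) → tv≈0 j)
  ... | yes (i , pivot≉0) = ℕ.s≤s (independent⇒≤ (λ a → u a ∘ suc) λ t tu≈0 a → begin
    t a                       ≡⟨ insertAt-punchIn t i (c t) a ⟨
    extend t (punchIn i a)    ≈⟨ indep (extend t) (λ j → trans (extended t j) (tu≈0′ t tu≈0 j)) (punchIn i a) ⟩
    0#                        ∎)
    where
    p = v i zero

    ratio : Vector Carrier k
    ratio a = p ⁻¹ * v (punchIn i a) zero

    u : Vector (Point (suc d)) k
    u a j = v (punchIn i a) j - ratio a * v i j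

    -- The pivot's coefficient that undoes the elimination: `extend t` represents over `v` the point
    -- that `t` represents over `u`.
    c : Vector Carrier k → Carrier
    c t = - 1# * sum (λ a → t a * ratio a)

    extend : Vector Carrier k → Vector Carrier (suc k)
    extend t = insertAt t i (c t)

    extended : ∀ t j → combination (extend t) v j ≈ combination t u j
    extended t j = begin
      sum f                                                        ≈⟨ sum-remove f ⟩
      f i + sum (removeAt f i)                                     ≈⟨ +-cong fᵢ (sum-cong f-rest) ⟩
      - 1# * v i j * sum (λ a → t a * ratio a)
        + sum (λ a → t a * v (punchIn i a) j)                      ≈⟨ +-congʳ (sum-* (- 1# * v i j) (λ a → t a * ratio a)) ⟨
      sum (λ a → - 1# * v i j * (t a * ratio a))
        + sum (λ a → t a * v (punchIn i a) j)                      ≈⟨ sum-+ _ (λ a → t a * v (punchIn i a) j) ⟨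
      sum (λ a → - 1# * v i j * (t a * ratio a) + t a * v (punchIn i a) j)
                                                                   ≈⟨ sum-cong (λ a → solve 4 (λ t r w z →
                                                                        :- con (+ 1) :* w :* (t :* r) :+ t :* z := t :* (z :- r :* w))
                                                                        refl (t a) (ratio a) (v i j) (v (punchIn i a) j)) ⟩
      combination t u j                                            ∎
      where
      f : Vector Carrier (suc k)
      f a = extend t a * v a j

      fᵢ : f i ≈ - 1# * v i j * sum (λ a → t a * ratio a)
      fᵢ = begin
        extend t i * v i j    ≡⟨ ≡.cong (_* v i j) (insertAt-lookup t i (c t)) ⟩
        c t * v i j           ≈⟨ solve 2 (λ s w → :- con (+ 1) :* s :* w := :- con (+ 1) :* w :* s) refl _ _ ⟩
        - 1# * v i j * sum (λ a → t a * ratio a) ∎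

      f-rest : ∀ a → f (punchIn i a) ≈ t a * v (punchIn i a) j
      f-rest a = *-congʳ (reflexive (insertAt-punchIn t i (c t) a))

    tu≈0′ : ∀ t → (∀ j → combination t (λ a → u a ∘ suc) j ≈ 0#) → ∀ j → combination t u j ≈ 0#
    tu≈0′ t tu≈0 zero = sum-0 λ a → begin
      t a * (v (punchIn i a) zero - p ⁻¹ * v (punchIn i a) zero * p)
        ≈⟨ solve 4 (λ t z q p → t :* (z :- q :* z :* p) := t :* (z :- p :* (q :* z))) refl _ _ (p ⁻¹) p ⟩
      t a * (v (punchIn i a) zero - p * (p ⁻¹ * v (punchIn i a) zero))
        ≈⟨ *-congˡ (+-congˡ (-‿cong (*-÷ pivot≉0 _))) ⟩
      t a * (v (punchIn i a) zero - v (punchIn i a) zero)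
        ≈⟨ solve 2 (λ t z → t :* (z :- z) := con (+ 0)) refl _ _ ⟩
      0# ∎
    tu≈0′ t tu≈0 (suc j) = tu≈0 j

  Respects≈ : Pred (Point d) 0ℓ → Set
  Respects≈ C = ∀ {x y} → (∀ j → x j ≈ y j) → x ∈ C → y ∈ C

  record IsSubspace (L : Pred (Point d) 0ℓ) : Set where
    field
      respects : Respects≈ L
      +-closed : ∀ {x y} → x ∈ L → y ∈ L → (λ j → x j + y j) ∈ L
      *-closed : ∀ r {x} → x ∈ L → (λ j → r * x j) ∈ L

  -- Independence in the quotient by `L`, stated without forming the quotient.
  IndependentModulo : Pred (Point d) 0ℓ → Vector (Point d) s → Set
  IndependentModulo L v = ∀ t → combination t v ∈ L → ∀ i → t i ≈ 0#

  sum-++ : ∀ m {n} (f : Vector Carrier (m ℕ.+ n)) → sum f ≈ sum (f ∘ (_↑ˡ n)) + sum (f ∘ (m ↑ʳ_))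
  sum-++ zero    f = sym (+-identityˡ _)
  sum-++ (suc m) f = trans (+-congˡ (sum-++ m (f ∘ suc))) (sym (+-assoc _ _ _))

  combination-* : ∀ r (t : Vector Carrier s) (v : Vector (Point d) s) j →
                  combination (λ i → r * t i) v j ≈ r * combination t v j
  combination-* r t v j = trans (sum-cong (λ i → *-assoc r (t i) (v i j))) (sum-* r (λ i → t i * v i j))

  -- The concatenation of `v` and `w` is independent: in a vanishing combination the `v`-part is
  -- minus a combination of `w`, hence in `L`, so its coefficients vanish, and then those of `w` do.
  independent-modulo-span : {L : Pred (Point d) 0ℓ} → Respects≈ L →
    {v : Vector (Point d) s} → IndependentModulo L v →
    {w : Vector (Point d) k} → LinearlyIndependent w → (∀ t → combination t w ∈ L) →
    s ℕ.+ k ℕ.≤ d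
  independent-modulo-span {d = d} {s = s} {k = k} L-resp {v} v-indep {w} w-indep w∈L = independent⇒≤ (v ++ w) vw-indep
    where
    vw-indep : LinearlyIndependent (v ++ w)
    vw-indep t vw≈0 = λ i → t≈0 i
      where
      t₁ = t ∘ (_↑ˡ k)
      t₂ = t ∘ (s ↑ʳ_)

      split≈0 : ∀ j → combination t₁ v j + combination t₂ w j ≈ 0#
      split≈0 j = begin
        combination t₁ v j + combination t₂ w j   ≈⟨ +-cong (sum-cong (λ i → *-congˡ (reflexive (≡.cong (λ h → h j) (lookup-++ˡ v w i)))))
                                                            (sum-cong (λ i → *-congˡ (reflexive (≡.cong (λ h → h j) (lookup-++ʳ v w i))))) ⟨
        _                                         ≈⟨ sum-++ s (λ i → t i * (v ++ w) i j) ⟨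
        combination t (v ++ w) j                  ≈⟨ vw≈0 j ⟩
        0#                                        ∎

      t₁≈0 : ∀ i → t₁ i ≈ 0#
      t₁≈0 = v-indep t₁ (L-resp (λ j → begin
        combination (λ i → - 1# * t₂ i) w j  ≈⟨ combination-* (- 1#) t₂ w j ⟩
        - 1# * combination t₂ w j            ≈⟨ solve 2 (λ a b → :- con (+ 1) :* b := a :- (a :+ b)) refl (combination t₁ v j) (combination t₂ w j) ⟩
        combination t₁ v j - (combination t₁ v j + combination t₂ w j)
                                             ≈⟨ +-congˡ (-‿cong (split≈0 j)) ⟩
        combination t₁ v j - 0#              ≈⟨ solve 1 (λ a → a :- con (+ 0) := a) refl _ ⟩
        combination t₁ v j                   ∎) (w∈L (λ i → - 1# * t₂ i)))

      t₂≈0 : ∀ i → t₂ i ≈ 0#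
      t₂≈0 = w-indep t₂ λ j → begin
        combination t₂ w j                        ≈⟨ +-identityˡ _ ⟨
        0# + combination t₂ w j                   ≈⟨ +-congʳ (sum-0 (λ i → trans (*-congʳ (t₁≈0 i)) (zeroˡ _))) ⟨
        combination t₁ v j + combination t₂ w j   ≈⟨ split≈0 j ⟩
        0#                                        ∎

      t≈0 : ∀ i → t i ≈ 0#
      t≈0 i with splitAt s i in eq
      ... | inj₁ a = ≡.subst (λ h → t h ≈ 0#) (splitAt⁻¹-↑ˡ eq) (t₁≈0 a)
      ... | inj₂ b = ≡.subst (λ h → t h ≈ 0#) (splitAt⁻¹-↑ʳ eq) (t₂≈0 b)

  -- A combination in `L′` is also in `L`, as is its `u`-term; so the `v`-part is in `L` and its
  -- coefficients vanish. What remains is a multiple of `u` in `L′`, so the multiplier is zero.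
  independent-∷ : {L L′ : Pred (Point d) 0ℓ} → IsSubspace L → IsSubspace L′ → L′ ⊆ L →
    {v : Vector (Point d) s} → IndependentModulo L v →
    ∀ {u} → u ∈ L → ¬ u ∈ L′ → IndependentModulo L′ (u Vector.∷ v)
  independent-∷ {L′ = L′} L-sub L′-sub L′⊆L {v} v-indep {u} u∈L u∉L′ t tuv∈L′ = λ where
      zero    → t₀≈0
      (suc i) → t′≈0 i
    where
    module L  = IsSubspace L-sub
    module L′ = IsSubspace L′-sub

    t′≈0 : ∀ i → t (suc i) ≈ 0#
    t′≈0 = v-indep (t ∘ suc) (L.respects
      (λ j → solve 3 (λ t u c → t :* u :+ c :+ :- con (+ 1) :* t :* u := c) refl (t zero) (u j) (combination (t ∘ suc) v j))
      (L.+-closed (L′⊆L tuv∈L′) (L.*-closed (- 1# * t zero) u∈L)))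

    t₀≈0 : t zero ≈ 0#
    t₀≈0 = by-contradiction λ t₀≉0 → u∉L′ (L′.respects (λ j → begin
      t zero ⁻¹ * combination t (u Vector.∷ v) j
        ≈⟨ *-congˡ (trans (+-congˡ (sum-0 (λ i → trans (*-congʳ (t′≈0 i)) (zeroˡ _)))) (+-identityʳ _)) ⟩
      t zero ⁻¹ * (t zero * u j)   ≈⟨ ⁻¹-cancelˡ t₀≉0 (u j) ⟩
      u j                          ∎) (L′.*-closed (t zero ⁻¹) tuv∈L′))

-- Lineality spaces, convexity of the norm, and cones.

module ConvexGeometry (em : ExcludedMiddle 0ℓ) (ℝ : RealField) where

  open import Data.Integer.Base using (+_)
  open import Relation.Unary using (_∈_)

  open OrderedField em ℝ
  open LinearAlgebra em ℝ
  open RealField ℝ hiding (zero)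
  open Euclidean ℝ

  private variable
    d s : ℕ

  norm² : Point d → Carrier
  norm² x = sum (λ j → x j * x j)

  Minimal : Pred (Point d) 0ℓ → Pred (Point d) 0ℓ
  Minimal C x = ∀ {y} → y ∈ C → norm² x ≤ norm² y

  -- Directions of lines through `x` inside `C`. For closed convex `C` they do not depend on the
  -- choice of `x` in `C`, which is what `translate` provides.
  Lineality : Point d → Pred (Point d) 0ℓ → Pred (Point d) 0ℓ
  Lineality x C v = ∀ t → (λ j → x j + t * v j) ∈ C

  Meet : {I : Set} → (I → Pred (Point d) 0ℓ) → Pred (Point d) 0ℓ
  Meet A x = ∀ i → x ∈ A i

  record ClosedConvex (C : Pred (Point d) 0ℓ) : Set where
    field
      closed : Closed C
      convex : Convex C

    respects : Respects≈ C
    respects {x} {y} x≈y x∈C = by-contradiction λ y∉C →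
      let ε , 0<ε , ball = closed y y∉C
          y-x≈0 = λ j → trans (+-congʳ (sym (x≈y j))) (-‿inverseʳ (x j))
          dist≈0 = sum-0 λ j → trans (*-congʳ (y-x≈0 j)) (zeroˡ _)
      in ball x (≤-<-trans (≤-reflexive dist≈0) (*-pos 0<ε 0<ε)) x∈C

    -- The points η (x + v / η) + (1 - η) y of C tend to y + v as η tends to 0.
    translate : ∀ {x v y} → v ∈ Lineality x C → y ∈ C → (λ j → y j + v j) ∈ C
    translate {x} {v} {y} v∈L y∈C = by-contradiction λ y+v∉C →
      let ε , 0<ε , ball = closed (λ j → y j + v j) y+v∉C
          w , w∈C , dist<ε² = approximate ε 0<ε
      in ball w dist<ε² w∈C
      where
      approximate : ∀ ε → 0# < ε → ∃[ w ] (w ∈ C × dist² (λ j → y j + v j) w < ε * ε)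
      approximate ε 0<ε = w , convex _ _ (v∈L (η ⁻¹)) y∈C η (<⇒≤ 0<η) η≤1 , dist<ε²
        where
        D = dist² x y
        Q = 1# + ε + D
        η = Q ⁻¹ * ε
        w : Point _
        w j = η * (x j + η ⁻¹ * v j) + (1# - η) * y j
        0≤D = sum-nonNeg λ j → sq-nonNeg (x j - y j)
        0<Q = +-pos (+-pos 0<1 (<⇒≤ 0<ε)) 0≤D
        0<η = *-pos (⁻¹-pos 0<Q) 0<ε
        Qη≈ε = *-÷ (>⇒≉ 0<Q) ε
        η≤1 = *-cancelˡ-≤ 0<Q (≤-respˡ-≈ (sym Qη≈ε) (≤-by (1# + D) (+-nonNeg 0≤1 0≤D)
                (solve 2 (λ ε D → (con (+ 1) :+ ε :+ D) :* con (+ 1) := ε :+ (con (+ 1) :+ D)) refl ε D)))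

        offset : ∀ j → y j + v j - w j ≈ - 1# * η * (x j - y j)
        offset j = begin
          y j + v j - w j
            ≈⟨ solve 5 (λ x y v η w → y :+ v :- (η :* (x :+ w :* v) :+ (con (+ 1) :- η) :* y)
                 := v :- η :* (w :* v) :- η :* (x :- y)) refl (x j) (y j) (v j) η (η ⁻¹) ⟩
          v j - η * (η ⁻¹ * v j) - η * (x j - y j)   ≈⟨ +-congʳ (+-congˡ (-‿cong (*-÷ (>⇒≉ 0<η) (v j)))) ⟩
          v j - v j - η * (x j - y j)
            ≈⟨ solve 3 (λ v η h → v :- v :- η :* h := :- con (+ 1) :* η :* h) refl (v j) η (x j - y j) ⟩
          - 1# * η * (x j - y j)                     ∎
          where open ≈-Reasoning

        dist≈ : dist² (λ j → y j + v j) w ≈ η * η * D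
        dist≈ = trans (sum-cong λ j → trans (*-cong (offset j) (offset j))
            (solve 2 (λ η h → (:- con (+ 1) :* η :* h) :* (:- con (+ 1) :* η :* h) := η :* η :* (h :* h)) refl η (x j - y j)))
          (sum-* (η * η) λ j → (x j - y j) * (x j - y j))

        0<Q²-D : 0# < 1# + ε + (ε + D) * Q
        0<Q²-D = +-pos (+-pos 0<1 (<⇒≤ 0<ε)) (*-nonNeg (+-nonNeg (<⇒≤ 0<ε) 0≤D) (<⇒≤ 0<Q))

        ε²-η²D : η * η * (1# + ε + (ε + D) * Q) ≈ ε * ε - η * η * D
        ε²-η²D = trans
          (solve 3 (λ ε η D → let Q = con (+ 1) :+ ε :+ D in
             η :* η :* (con (+ 1) :+ ε :+ (ε :+ D) :* Q) := (Q :* η) :* (Q :* η) :- η :* η :* D) refl ε η D)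
          (+-congʳ (*-cong Qη≈ε Qη≈ε))

        dist<ε² : dist² (λ j → y j + v j) w < ε * ε
        dist<ε² = ≤-<-trans (≤-reflexive dist≈)
          (0<-⇒< (<-≤-trans (*-pos (*-pos 0<η 0<η) 0<Q²-D) (≤-reflexive ε²-η²D)))

    -- Closedness under sums is where `translate` enters: it moves the point x + t v of `C` by t w.
    lineality-isSubspace : ∀ {x} → IsSubspace (Lineality x C)
    lineality-isSubspace {x} = record
      { respects = λ v≈w v∈L t → respects (λ j → +-congˡ (*-congˡ (v≈w j))) (v∈L t)
      ; +-closed = λ {v} {w} v∈L w∈L t → respects
          (λ j → solve 4 (λ x v w t → x :+ t :* v :+ t :* w := x :+ t :* (v :+ w)) refl (x j) (v j) (w j) t)
          (translate (scale t w∈L) (v∈L t))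
      ; *-closed = scale
      }
      where
      scale : ∀ r {v} → v ∈ Lineality x C → (λ j → r * v j) ∈ Lineality x C
      scale r {v} v∈L t = respects (λ j → +-congˡ (*-assoc t r (v j))) (v∈L (t * r))

  Meet-closedConvex : {I : Set} {A : I → Pred (Point d) 0ℓ} → (∀ i → ClosedConvex (A i)) → ClosedConvex (Meet A)
  Meet-closedConvex {A = A} cc = record
    { closed = λ x x∉⋂A → let i , x∉Aᵢ = by-contradiction λ ∄i → x∉⋂A λ i → by-contradiction (∄i ∘ (i ,_))
                              ε , 0<ε , ball = ClosedConvex.closed (cc i) x x∉Aᵢ
                          in ε , 0<ε , λ y near y∈⋂A → ball y near (y∈⋂A i)
    ; convex = λ x y x∈⋂A y∈⋂A t 0≤t t≤1 i → ClosedConvex.convex (cc i) x y (x∈⋂A i) (y∈⋂A i) t 0≤t t≤1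
    }

  -- In each coordinate the slack is t (1 - t) times the squared difference.
  norm²-convex : ∀ (x y : Point d) t → 0# ≤ t → t ≤ 1# →
    norm² (λ j → t * x j + (1# - t) * y j) ≤ t * norm² x + (1# - t) * norm² y
  norm²-convex x y t 0≤t t≤1 = begin
    norm² (λ j → t * x j + (1# - t) * y j)
      ≤⟨ sum-mono-≤ (λ j → ≤-by _ (*-nonNeg (*-nonNeg 0≤t (≤⇒0≤- t≤1)) (sq-nonNeg (x j - y j)))
           (solve 3 (λ x y t → let u = con (+ 1) :- t ; z = t :* x :+ u :* y in
              t :* (x :* x) :+ u :* (y :* y) := z :* z :+ t :* u :* ((x :- y) :* (x :- y))) refl (x j) (y j) t)) ⟩
    sum (λ j → t * (x j * x j) + (1# - t) * (y j * y j))
      ≈⟨ sum-+ (λ j → t * (x j * x j)) (λ j → (1# - t) * (y j * y j)) ⟩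
    sum (λ j → t * (x j * x j)) + sum (λ j → (1# - t) * (y j * y j))
      ≈⟨ +-cong (sum-* t (λ j → x j * x j)) (sum-* (1# - t) (λ j → y j * y j)) ⟩
    t * norm² x + (1# - t) * norm² y ∎
    where open ≤-Reasoning

  ball-convex : ∀ r → Convex {d} (λ z → norm² z < r)
  ball-convex r x y x<r y<r t 0≤t t≤1 = ≤-<-trans (norm²-convex x y t 0≤t t≤1) mean<r
    where
    a = norm² x
    b = norm² y
    mean<r : t * a + (1# - t) * b < r
    mean<r with total a b
    ... | inj₁ a≤b = ≤-<-trans (≤-by _ (*-nonNeg 0≤t (≤⇒0≤- a≤b))
                       (solve 3 (λ a b t → b := t :* a :+ (con (+ 1) :- t) :* b :+ t :* (b :- a)) refl a b t)) y<r
    ... | inj₂ b≤a = ≤-<-trans (≤-by _ (*-nonNeg (≤⇒0≤- t≤1) (≤⇒0≤- b≤a))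
                       (solve 3 (λ a b t → let u = con (+ 1) :- t in a := t :* a :+ u :* b :+ u :* (a :- b)) refl a b t)) x<r

  -- The homogenised form of membership: `z` lies in the dilate r C. Nonnegative combinations can
  -- then be added term by term, with no normalisation of weights.
  Cone : Pred (Point d) 0ℓ → Carrier → Pred (Point d) 0ℓ
  Cone C r z = 0# ≤ r × ∃[ c ] (c ∈ C × (∀ j → z j ≈ r * c j))

  module _ {C : Pred (Point d) 0ℓ} (C-convex : Convex C) where

    -- Dividing by r + r′ gives a convex combination of weight θ = r / (r + r′). If the sum is zero,
    -- both points are the origin and any point of `C` is a witness.
    cone-+ : ∀ {r r′ z z′} → Cone C r z → Cone C r′ z′ → Cone C (r + r′) (λ j → z j + z′ j)
    cone-+ {r} {r′} {z} {z′} (0≤r , c , c∈C , z≈) (0≤r′ , c′ , c′∈C , z′≈) with em {r + r′ ≈ 0#}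
    ... | yes R≈0 = +-nonNeg 0≤r 0≤r′ , c , c∈C , λ j → begin
          z j + z′ j                ≈⟨ +-cong (z≈ j) (trans (z′≈ j) (trans (*-congʳ r′≈0) (zeroˡ _))) ⟩
          r * c j + 0#              ≈⟨ +-congˡ (trans (sym (zeroˡ _)) (*-congʳ (sym r′≈0))) ⟩
          r * c j + r′ * c j        ≈⟨ distribʳ (c j) r r′ ⟨
          (r + r′) * c j            ∎
          where
          open ≈-Reasoning
          r′≈0 = ≤-antisym (≤-respʳ-≈ R≈0 (≤-by r 0≤r (+-comm r r′))) 0≤r′
    ... | no R≉0 = 0≤R , _ , C-convex c c′ c∈C c′∈C θ 0≤θ θ≤1 , λ j → begin
          z j + z′ j                                          ≈⟨ +-cong (z≈ j) (z′≈ j) ⟩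
          r * c j + r′ * c′ j                                 ≈⟨ solve 4 (λ r r′ c c′ → r :* c :+ r′ :* c′ := r :* c :+ (r :+ r′ :- r) :* c′) refl r r′ (c j) (c′ j) ⟩
          r * c j + (R - r) * c′ j                            ≈⟨ +-cong (*-congʳ Rθ≈r) (*-congʳ (+-congˡ (-‿cong Rθ≈r))) ⟨
          R * θ * c j + (R - R * θ) * c′ j                    ≈⟨ solve 4 (λ R θ c c′ → R :* θ :* c :+ (R :- R :* θ) :* c′ := R :* (θ :* c :+ (con (+ 1) :- θ) :* c′)) refl R θ (c j) (c′ j) ⟩
          R * (θ * c j + (1# - θ) * c′ j)                     ∎
          where
          open ≈-Reasoning
          R = r + r′
          θ = R ⁻¹ * r
          0≤R = +-nonNeg 0≤r 0≤r′
          0<R = 0≤R , R≉0 ∘ sym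
          Rθ≈r = *-÷ R≉0 r
          0≤θ = *-nonNeg (<⇒≤ (⁻¹-pos 0<R)) 0≤r
          θ≤1 = *-cancelˡ-≤ 0<R (≤-by r′ 0≤r′ (trans (*-identityʳ R) (+-congʳ (sym Rθ≈r))))

    -- Only points of nonzero weight must lie in `C`: in Radon's argument y j may be missing from A
    -- j when its weight is zero. The point `c` replaces the points of weight zero.
    cone-combination : ∀ {c} → c ∈ C → (a : Vector Carrier s) (y : Vector (Point d) s) →
      (∀ i → 0# ≤ a i) → (∀ i → ¬ a i ≈ 0# → y i ∈ C) → Cone C (sum a) (combination a y)
    cone-combination {zero}  {c} c∈C a y 0≤a y∈C = ≤-refl , c , c∈C , λ j → sym (zeroˡ (c j))
    cone-combination {suc s} {c} c∈C a y 0≤a y∈C =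
      cone-+ head (cone-combination c∈C (a ∘ suc) (y ∘ suc) (0≤a ∘ suc) (y∈C ∘ suc))
      where
      head : Cone C (a zero) (λ j → a zero * y zero j)
      head with em {a zero ≈ 0#}
      ... | yes a₀≈0 = 0≤a zero , c , c∈C , λ j → trans (*-congʳ a₀≈0) (trans (zeroˡ _) (sym (trans (*-congʳ a₀≈0) (zeroˡ _))))
      ... | no  a₀≉0 = 0≤a zero , y zero , y∈C zero a₀≉0 , λ j → refl

-- Radon's argument modulo the lineality space.

module Radon (em : ExcludedMiddle 0ℓ) (ℝ : RealField) where

  open import Data.Integer.Base using (+_)
  open import Relation.Unary using (_∈_)

  open OrderedField em ℝ
  open LinearAlgebra em ℝ
  open ConvexGeometry em ℝ
  open RealField ℝ hiding (zero)
  open Euclidean ℝ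

  _⁺ _⁻ : Carrier → Carrier
  r ⁺ with total 0# r
  ... | inj₁ _ = r
  ... | inj₂ _ = 0#
  r ⁻ with total 0# r
  ... | inj₁ _ = 0#
  ... | inj₂ _ = - 1# * r

  ⁺-nonNeg : ∀ r → 0# ≤ r ⁺
  ⁺-nonNeg r with total 0# r
  ... | inj₁ 0≤r = 0≤r
  ... | inj₂ _   = ≤-refl

  ⁻-nonNeg : ∀ r → 0# ≤ r ⁻
  ⁻-nonNeg r with total 0# r
  ... | inj₁ _   = ≤-refl
  ... | inj₂ r≤0 = ≤-by _ (≤⇒0≤- r≤0) (solve 1 (λ r → :- con (+ 1) :* r := con (+ 0) :+ (con (+ 0) :- r)) refl r)

  ⁺-⁻ : ∀ r → r ≈ r ⁺ - r ⁻
  ⁺-⁻ r with total 0# r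
  ... | inj₁ _ = solve 1 (λ r → r := r :- con (+ 0)) refl r
  ... | inj₂ _ = solve 1 (λ r → r := con (+ 0) :- :- con (+ 1) :* r) refl r

  ⁺≈0⊎⁻≈0 : ∀ r → r ⁺ ≈ 0# ⊎ r ⁻ ≈ 0#
  ⁺≈0⊎⁻≈0 r with total 0# r
  ... | inj₁ _ = inj₂ refl
  ... | inj₂ _ = inj₁ refl

  module _ {d s} {A : Fin s → Pred (Point d) 0ℓ} (A-cc : ∀ i → ClosedConvex (A i))
           {x : Point d} (x∈⋂A : x ∈ Meet A) (x-min : Minimal (Meet A) x)
           {y : Vector (Point d) s} (y∈A : ∀ i j → i ≢ j → y i ∈ A j)
           (y<x : ∀ i → norm² (y i) < norm² x) where

    private
      L : Pred (Point d) 0ℓ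
      L = Lineality x (Meet A)

      module L = IsSubspace (ClosedConvex.lineality-isSubspace (Meet-closedConvex A-cc) {x})

    -- Otherwise combination a y / sum a would be a point of norm less than x
    -- in all the sets: in A j with a j ≈ 0 as a mean of points y i with i ≢ j,
    -- and in A j with b j ≈ 0 as it differs by an element of L from a mean of x
    -- and of points y i with i ≢ j.
    sum-weights≈0 : (a b : Vector Carrier s) → (∀ i → 0# ≤ a i) → (∀ i → 0# ≤ b i) →
      (∀ j → a j ≈ 0# ⊎ b j ≈ 0#) → sum b ≤ sum a →
      (λ j → combination a y j - (combination b y j + (sum a - sum b) * x j)) ∈ L → sum a ≈ 0#
    sum-weights≈0 a b 0≤a 0≤b disjoint q≤p l∈L = by-contradiction λ p≉0 →
      -- A nonzero sum supplies an index, hence a point `y i` showing that the open ball is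
      -- inhabited.
      let i , aᵢ≉0 = by-contradiction λ ∄i → p≉0 (sum-0 λ i → by-contradiction (∄i ∘ (i ,_)))
          _ , z , z<x , ay≈pz = cone-combination (ball-convex (norm² x)) (y<x i) a y 0≤a λ i _ → y<x i
      in <⇒≱ z<x (x-min λ j → z∈A p≉0 z ay≈pz j (disjoint j))
      where
      p = sum a
      q = sum b
      l : Point d
      l j = combination a y j - (combination b y j + (p - q) * x j)

      weight≢ : ∀ {c : Vector Carrier s} {j} → c j ≈ 0# → ∀ i → ¬ c i ≈ 0# → y i ∈ A j
      weight≢ {c} {j} cⱼ≈0 i cᵢ≉0 = y∈A i j λ { ≡.refl → cᵢ≉0 cⱼ≈0 }

      z∈A : ¬ p ≈ 0# → ∀ z → (∀ j → combination a y j ≈ p * z j) →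
            ∀ j → a j ≈ 0# ⊎ b j ≈ 0# → z ∈ A j
      z∈A p≉0 z ay≈pz j (inj₁ aⱼ≈0) =
        let _ , c , c∈A , ay≈pc = cone-combination (ClosedConvex.convex (A-cc j)) (x∈⋂A j) a y 0≤a (weight≢ aⱼ≈0)
        in ClosedConvex.respects (A-cc j) (λ j → *-cancelˡ p≉0 (trans (sym (ay≈pc j)) (ay≈pz j))) c∈A
      z∈A p≉0 z ay≈pz j (inj₂ bⱼ≈0) =
        let A-convex = ClosedConvex.convex (A-cc j)
            -- Giving `x` the weight p - q, nonnegative as q ≤ p, raises the total weight from q to
            -- p, so that dividing by p yields a true mean.
            _ , c , c∈A , by+x≈ = cone-+ A-convex
              (cone-combination A-convex (x∈⋂A j) b y 0≤b (weight≢ bⱼ≈0))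
              (≤⇒0≤- q≤p , x , x∈⋂A j , λ j → refl)
        in ClosedConvex.respects (A-cc j)
             (λ j → begin
               c j + p ⁻¹ * l j        ≈⟨ +-congʳ (⁻¹-cancelˡ p≉0 (c j)) ⟨
               p ⁻¹ * (p * c j) + p ⁻¹ * l j
                 ≈⟨ +-congʳ (*-congˡ (trans (by+x≈ j) (*-congʳ (solve 2 (λ p q → q :+ (p :- q) := p) refl p q)))) ⟨
               p ⁻¹ * (combination b y j + (p - q) * x j) + p ⁻¹ * l j
                 ≈⟨ solve 3 (λ p a b → p :* b :+ p :* (a :- b) := p :* a) refl (p ⁻¹) (combination a y j) _ ⟩
               p ⁻¹ * combination a y j   ≈⟨ *-congˡ (ay≈pz j) ⟩
               p ⁻¹ * (p * z j)           ≈⟨ ⁻¹-cancelˡ p≉0 (z j) ⟩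
               z j                        ∎)
             (ClosedConvex.translate (A-cc j) (λ t → L.*-closed (p ⁻¹) l∈L t j) c∈A)
        where open ≈-Reasoning

    -- With `a` and `b` the positive and negative parts of `t`, membership in `L` says that
    -- `combination a y` and `combination b y` plus a multiple of `x` agree modulo `L`.
    -- `sum-weights≈0` kills the larger of the two sums, so both are zero, and nonnegative terms
    -- with sum zero vanish.
    offsets-independent : IndependentModulo L (λ i j → y i j - x j)
    offsets-independent t tu∈L i = begin
      t i               ≈⟨ ⁺-⁻ (t i) ⟩
      t i ⁺ - t i ⁻     ≈⟨ +-cong (sum≈0⇒≈0 (⁺-nonNeg ∘ t) p≈0 i) (-‿cong (sum≈0⇒≈0 (⁻-nonNeg ∘ t) q≈0 i)) ⟩
      0# - 0#           ≈⟨ -‿inverseʳ 0# ⟩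
      0#                ∎
      where
      open ≈-Reasoning
      a = λ i → t i ⁺
      b = λ i → t i ⁻
      p = sum a
      q = sum b

      tu≈ : ∀ j → combination t (λ i j → y i j - x j) j ≈ combination a y j - (combination b y j + (p - q) * x j)
      tu≈ j = begin
        sum (λ i → t i * (y i j - x j))
          ≈⟨ sum-cong (λ i → trans (*-congʳ (⁺-⁻ (t i)))
               (solve 4 (λ a b y x → (a :- b) :* (y :- x) := a :* y :+ (:- con (+ 1) :* (b :* y) :+ (:- x :* a :+ x :* b)))
                 refl (a i) (b i) (y i j) (x j))) ⟩
        sum (λ i → a i * y i j + (- 1# * (b i * y i j) + (- x j * a i + x j * b i)))
          ≈⟨ trans (sum-+ (λ i → a i * y i j) _) (+-congˡ (trans (sum-+ (λ i → - 1# * (b i * y i j)) _)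
               (+-cong (sum-* (- 1#) (λ i → b i * y i j)) (trans (sum-+ (λ i → - x j * a i) (λ i → x j * b i)) (+-cong (sum-* (- x j) a) (sum-* (x j) b)))))) ⟩
        combination a y j + (- 1# * combination b y j + (- x j * p + x j * q))
          ≈⟨ solve 5 (λ a b x p q → a :+ (:- con (+ 1) :* b :+ (:- x :* p :+ x :* q)) := a :- (b :+ (p :- q) :* x))
               refl (combination a y j) (combination b y j) (x j) p q ⟩
        combination a y j - (combination b y j + (p - q) * x j) ∎

      l∈L = L.respects tu≈ tu∈L

      l′∈L : (λ j → combination b y j - (combination a y j + (q - p) * x j)) ∈ L
      l′∈L = L.respects (λ j → solve 5 (λ a b x p q →
          :- con (+ 1) :* (a :- (b :+ (p :- q) :* x)) := b :- (a :+ (q :- p) :* x))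
          refl (combination a y j) (combination b y j) (x j) p q)
        (L.*-closed (- 1#) l∈L)

      sums≈0 : p ≈ 0# × q ≈ 0#
      sums≈0 with total q p
      ... | inj₁ q≤p = p≈0 , ≤-antisym (≤-respʳ-≈ p≈0 q≤p) (sum-nonNeg (⁻-nonNeg ∘ t))
        where p≈0 = sum-weights≈0 a b (⁺-nonNeg ∘ t) (⁻-nonNeg ∘ t) (⁺≈0⊎⁻≈0 ∘ t) q≤p l∈L
      ... | inj₂ p≤q = ≤-antisym (≤-respʳ-≈ q≈0 p≤q) (sum-nonNeg (⁺-nonNeg ∘ t)) , q≈0
        where q≈0 = sum-weights≈0 b a (⁻-nonNeg ∘ t) (⁺-nonNeg ∘ t) (swap ∘ ⁺≈0⊎⁻≈0 ∘ t) p≤q l′∈L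

      p≈0 = proj₁ sums≈0
      q≈0 = proj₂ sums≈0

-- Existence and uniqueness of the point of least norm.

module NearestPoint (em : ExcludedMiddle 0ℓ) (ℝ : RealField) where

  open import Data.Integer.Base using (+_)
  open import Relation.Unary using (_∈_; Satisfiable)

  open OrderedField em ℝ
  open LinearAlgebra em ℝ
  open ConvexGeometry em ℝ
  open RealField ℝ hiding (zero)
  open Euclidean ℝ

  ½ : Carrier
  ½ = (1# + 1#) ⁻¹

  0<2 : 0# < 1# + 1#
  0<2 = +-pos 0<1 0≤1

  2*½ : (1# + 1#) * ½ ≈ 1#
  2*½ = *-inverseʳ _ (>⇒≉ 0<2)

  sum-linear : ∀ {n} a b (f g : Vector Carrier n) → sum (λ i → a * f i + b * g i) ≈ a * sum f + b * sum g
  sum-linear a b f g = trans (sum-+ (λ i → a * f i) (λ i → b * g i)) (+-cong (sum-* a f) (sum-* b g))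

  coordinate-sq≤norm² : ∀ {d} (x : Point d) j → x j * x j ≤ norm² x
  coordinate-sq≤norm² x Fin.zero    = ≤-by _ (sum-nonNeg (λ j → sq-nonNeg (x (Fin.suc j)))) refl
  coordinate-sq≤norm² x (Fin.suc j) =
    ≤-trans (coordinate-sq≤norm² (x ∘ Fin.suc) j) (≤-by _ (sq-nonNeg (x Fin.zero)) (+-comm _ _))

  module _ {d} {C : Pred (Point d) 0ℓ} (C-cc : ClosedConvex C) {y₀ : Point d} (y₀∈C : y₀ ∈ C) where

    open ClosedConvex C-cc

    private
      LowerBound : Pred Carrier 0ℓ
      LowerBound a = ∀ {y} → y ∈ C → a ≤ norm² y

      -- Completeness provides suprema, so the infimum of the squared norms is the supremum of their
      -- lower bounds.
      infimum : ∃[ m ] (UpperBound LowerBound m × (∀ {b} → UpperBound LowerBound b → m ≤ b))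
      infimum = complete LowerBound (0# , λ {y} _ → sum-nonNeg λ j → sq-nonNeg (y j))
                                    (norm² y₀ , λ a∈ → a∈ y₀∈C)

      m : Carrier
      m = proj₁ infimum

      m≤ : LowerBound m
      m≤ y∈C = proj₂ (proj₂ infimum) λ a∈ → a∈ y∈C

      -- The error is squared so that the diameter is linear in δ, at most 2 δ.
      Near : Carrier → Pred (Point d) 0ℓ
      Near δ y = y ∈ C × norm² y ≤ m + δ * δ

      near : ∀ {δ} → 0# < δ → Satisfiable (Near δ)
      near {δ} 0<δ = by-contradiction λ ∄y →
        <⇒≱ (*-pos 0<δ 0<δ) (≤-by _ (≤⇒0≤- (proj₁ (proj₂ infimum) {m + δ * δ} λ {y} y∈C →
            ≮⇒≥ λ y< → ∄y (y , y∈C , <⇒≤ y<)))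
          (solve 2 (λ m e → con (+ 0) := e :+ (m :- (m :+ e))) refl m (δ * δ)))

      near-mono : ∀ {δ η y} → 0# ≤ δ → δ ≤ η → Near δ y → Near η y
      near-mono {δ} {η} {y} 0≤δ δ≤η (y∈C , y≤) = y∈C , ≤-trans y≤ (+-monoʳ-≤ m
        (sq-mono-≤ (≤⇒0≤- δ≤η) (+-nonNeg (≤-trans 0≤δ δ≤η) 0≤δ)))

      -- The parallelogram law bounds the distance of y and z, as their midpoint
      -- lies in C and so has squared norm at least m.
      near-dist² : ∀ {δ y z} → Near δ y → Near δ z → norm² (λ j → y j - z j) ≤ (δ + δ) * (δ + δ)
      near-dist² {δ} {y} {z} (y∈C , y≤) (z∈C , z≤) = begin
        norm² (λ j → y j - z j)
          ≈⟨ sum-cong (λ j → trans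
               (solve 2 (λ y z → (y :- z) :* (y :- z) := con (+ 2) :* (y :* y :+ z :* z) :- (y :+ z) :* (y :+ z)) refl (y j) (z j))
               (+-congˡ (-‿cong (*-cong (y+z≈2mid j) (y+z≈2mid j))))) ⟩
        sum (λ j → two * (y j * y j + z j * z j) - (mid j + mid j) * (mid j + mid j))
          ≈⟨ sum-cong (λ j → solve 3 (λ y z w → con (+ 2) :* (y :+ z) :- (w :+ w) :* (w :+ w) := con (+ 1) :* (con (+ 2) :* y :+ con (+ 2) :* z) :+ :- con (+ 4) :* (w :* w))
               refl (y j * y j) (z j * z j) (mid j)) ⟩
        sum (λ j → 1# * (two * (y j * y j) + two * (z j * z j)) + - four * (mid j * mid j))
          ≈⟨ sum-linear 1# (- four) (λ j → two * (y j * y j) + two * (z j * z j)) (λ j → mid j * mid j) ⟩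
        1# * sum (λ j → two * (y j * y j) + two * (z j * z j)) + - four * norm² mid
          ≈⟨ +-congʳ (*-congˡ (sum-linear two two (λ j → y j * y j) (λ j → z j * z j))) ⟩
        1# * (two * norm² y + two * norm² z) + - four * norm² mid
          ≤⟨ ≤-by _ (+-nonNeg (*-nonNeg (<⇒≤ 0<2) (+-nonNeg (≤⇒0≤- y≤) (≤⇒0≤- z≤)))
                              (*-nonNeg (+-nonNeg (+-nonNeg (<⇒≤ 0<2) 0≤1) 0≤1) (≤⇒0≤- (m≤ mid∈C))))
               (solve 5 (λ m δ y z w → (δ :+ δ) :* (δ :+ δ)
                  := con (+ 1) :* (con (+ 2) :* y :+ con (+ 2) :* z) :+ :- con (+ 4) :* w
                  :+ (con (+ 2) :* ((m :+ δ :* δ :- y) :+ (m :+ δ :* δ :- z)) :+ con (+ 4) :* (w :- m)))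
                refl m δ (norm² y) (norm² z) (norm² mid)) ⟩
        (δ + δ) * (δ + δ) ∎
        where
        open ≤-Reasoning
        two  = 1# + 1#
        four = 1# + 1# + 1# + 1#
        mid : Point d
        mid j = ½ * y j + (1# - ½) * z j

        ½≤1 : ½ ≤ 1#
        ½≤1 = *-cancelˡ-≤ 0<2 (≤-by 1# 0≤1 (trans (*-identityʳ _) (+-congʳ (sym 2*½))))
        mid∈C = convex y z y∈C z∈C ½ (<⇒≤ (⁻¹-pos 0<2)) ½≤1

        y+z≈2mid : ∀ j → y j + z j ≈ mid j + mid j
        y+z≈2mid j = trans
          (solve 2 (λ y z → y :+ z := con (+ 1) :* y :+ (con (+ 2) :- con (+ 1)) :* z) refl (y j) (z j))
          (trans (+-cong (*-congʳ (sym 2*½)) (*-congʳ (+-congˡ (-‿cong (sym 2*½)))))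
            (solve 3 (λ y z h → con (+ 2) :* h :* y :+ (con (+ 2) :- con (+ 2) :* h) :* z
               := h :* y :+ (con (+ 1) :- h) :* z :+ (h :* y :+ (con (+ 1) :- h) :* z)) refl (y j) (z j) ½))

      near-close : ∀ {δ y z} → 0# < δ → Near δ y → Near δ z → ∀ j → y j ≤ z j + (δ + δ)
      near-close {δ} {y} {z} 0<δ y∈ z∈ j = ≤-by _ (≤⇒0≤- y-z≤2δ)
        (solve 3 (λ y z e → z :+ e := y :+ (e :- (y :- z))) refl (y j) (z j) (δ + δ))
        where
        y-z≤2δ : y j - z j ≤ δ + δ
        y-z≤2δ = sq-cancel-≤ (<⇒≤ (+-pos 0<δ (<⇒≤ 0<δ)))
          (≤-trans (coordinate-sq≤norm² (λ j → y j - z j) j) (near-dist² y∈ z∈))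

      -- Eventual lower bounds of a coordinate as δ shrinks; their supremum is its lower limit.
      -- Taking it in each coordinate builds the limit point from order completeness, with no Cauchy
      -- sequence to choose.
      Below : Fin d → Pred Carrier 0ℓ
      Below j a = ∃[ δ ] (0# < δ × (∀ y → Near δ y → a ≤ y j))

      below-bounded : ∀ {δ y} → 0# < δ → Near δ y → ∀ j → UpperBound (Below j) (y j + (δ + δ))
      below-bounded {δ} {y} 0<δ y∈ j (η , 0<η , a≤) with total δ η
      ... | inj₁ δ≤η = ≤-trans (a≤ y (near-mono (<⇒≤ 0<δ) δ≤η y∈)) (≤-by _ (<⇒≤ (+-pos 0<δ (<⇒≤ 0<δ))) refl)
      ... | inj₂ η≤δ = let z , z∈ = near 0<η in
        ≤-trans (a≤ z z∈) (near-close 0<δ (near-mono (<⇒≤ 0<η) η≤δ z∈) y∈ j)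

      below : ∀ {δ y} → 0# < δ → Near δ y → ∀ j → y j - (δ + δ) ∈ Below j
      below {δ} {y} 0<δ y∈ j = δ , 0<δ , λ z z∈ → ≤-by _ (≤⇒0≤- (near-close 0<δ y∈ z∈ j))
        (solve 3 (λ y z e → z := y :- e :+ (z :+ e :- y)) refl (y j) (z j) (δ + δ))

      limit : ∀ j → ∃[ s ] (UpperBound (Below j) s × (∀ {b} → UpperBound (Below j) b → s ≤ b))
      limit j = let y , y∈ = near 0<1 in
        complete (Below j) (_ , below 0<1 y∈ j) (_ , below-bounded 0<1 y∈ j)

      x : Point d
      x j = proj₁ (limit j)

      -- With `above-x`: in every coordinate the limit is within 2 δ of each point of `Near δ`, in
      -- the form that `sq-mono-≤` and `sq≤` expect.
      below-x : ∀ {δ y} → 0# < δ → Near δ y → ∀ j → 0# ≤ δ + δ - (x j - y j)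
      below-x {δ} {y} 0<δ y∈ j = ≤-respʳ-≈
        (solve 3 (λ x y e → y :+ e :- x := e :- (x :- y)) refl (x j) (y j) (δ + δ))
        (≤⇒0≤- (proj₂ (proj₂ (limit j)) (below-bounded 0<δ y∈ j)))

      above-x : ∀ {δ y} → 0# < δ → Near δ y → ∀ j → 0# ≤ δ + δ + (x j - y j)
      above-x {δ} {y} 0<δ y∈ j = ≤-respʳ-≈
        (solve 3 (λ x y e → x :- (y :- e) := e :+ (x :- y)) refl (x j) (y j) (δ + δ))
        (≤⇒0≤- (proj₁ (proj₂ (limit j)) (below 0<δ y∈ j)))

      N : Carrier
      N = fromℕ d

      x∈C : x ∈ C
      x∈C = by-contradiction λ x∉C →
        let ε , 0<ε , ball = closed x x∉C
            y , (y∈C , _) , close = approximate 0<ε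
        in ball y close y∈C
        where
        approximate : ∀ {ε} → 0# < ε → ∃[ y ] (y ∈ Near ((1# + N + (1# + N)) ⁻¹ * ε) × dist² x y < ε * ε)
        approximate {ε} 0<ε = let y , y∈ = near 0<δ in y , y∈ , 0<-⇒<
          (<-≤-trans (*-pos (*-pos 0<e 0<e) (+-pos (+-pos 0<1 (fromℕ-nonNeg d)) (*-nonNeg (fromℕ-nonNeg d) (fromℕ-nonNeg d))))
            (≤-by _ (≤⇒0≤- (dist≤ y∈)) (trans (+-congʳ (*-cong (sym Qδ≈ε) (sym Qδ≈ε)))
              (solve 3 (λ δ N D → let Q = con (+ 1) :+ N :+ (con (+ 1) :+ N) ; e = δ :+ δ in
                 Q :* δ :* (Q :* δ) :- D := e :* e :* (con (+ 1) :+ N :+ N :* N) :+ (N :* (e :* e) :- D)) refl δ N _))))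
          where
          -- With δ = ε / Q one has ε² = (2 δ)² (1 + N)², while the squared distance is at most N (2
          -- δ)²; the difference is at least (2 δ)² (1 + N + N²).
          Q = 1# + N + (1# + N)
          0<Q = +-pos (+-pos 0<1 (fromℕ-nonNeg d)) (+-nonNeg 0≤1 (fromℕ-nonNeg d))
          δ = Q ⁻¹ * ε
          Qδ≈ε = *-÷ (>⇒≉ 0<Q) ε
          0<δ = *-pos (⁻¹-pos 0<Q) 0<ε
          0<e = +-pos 0<δ (<⇒≤ 0<δ)

          dist≤ : ∀ {y} → y ∈ Near δ → dist² x y ≤ N * ((δ + δ) * (δ + δ))
          dist≤ y∈ = ≤-respʳ-≈ (sum-const d ((δ + δ) * (δ + δ)))
            (sum-mono-≤ λ j → sq-mono-≤ (below-x 0<δ y∈ j) (above-x 0<δ y∈ j))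

      M : Carrier
      M = 1# + (1# + 1#) * (N + norm² x)

      0≤N+x² : 0# ≤ N + norm² x
      0≤N+x² = +-nonNeg (fromℕ-nonNeg d) (sum-nonNeg λ j → sq-nonNeg (x j))

      -- a² - b² = 2 a (a - b) - (a - b)² is at most 2 e times the absolute value of a, hence at
      -- most e (1 + a²). The error involves only `a`, a coordinate of the limit, so it is uniform
      -- in the near point.
      sq≤ : ∀ {e a b} → 0# ≤ e - (a - b) → 0# ≤ e + (a - b) → 0# ≤ e → a * a ≤ b * b + e * (1# + a * a)
      sq≤ {e} {a} {b} 0≤e-h 0≤e+h 0≤e with total 0# a
      ... | inj₁ 0≤a = ≤-by _ (+-nonNeg (+-nonNeg (*-nonNeg 0≤e (sq-nonNeg (a - 1#)))
                                                  (*-nonNeg (*-nonNeg (<⇒≤ 0<2) 0≤a) 0≤e-h)) (sq-nonNeg (a - b)))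
        (solve 3 (λ e a b → b :* b :+ e :* (con (+ 1) :+ a :* a)
           := a :* a :+ (e :* ((a :- con (+ 1)) :* (a :- con (+ 1))) :+ con (+ 2) :* a :* (e :- (a :- b)) :+ (a :- b) :* (a :- b)))
          refl e a b)
      ... | inj₂ a≤0 = ≤-by _ (+-nonNeg (+-nonNeg (*-nonNeg 0≤e (sq-nonNeg (a + 1#)))
                                                  (*-nonNeg (*-nonNeg (<⇒≤ 0<2) (≤⇒0≤- a≤0)) 0≤e+h)) (sq-nonNeg (a - b)))
        (solve 3 (λ e a b → b :* b :+ e :* (con (+ 1) :+ a :* a)
           := a :* a :+ (e :* ((a :+ con (+ 1)) :* (a :+ con (+ 1))) :+ con (+ 2) :* (con (+ 0) :- a) :* (e :+ (a :- b)) :+ (a :- b) :* (a :- b)))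
          refl e a b)

      norm²≤m+ : ∀ {δ} → 0# < δ → δ ≤ 1# → norm² x ≤ m + δ * M
      norm²≤m+ {δ} 0<δ δ≤1 = let y , y∈ = near 0<δ in begin
        norm² x
          ≤⟨ sum-mono-≤ (λ j → sq≤ (below-x 0<δ y∈ j) (above-x 0<δ y∈ j) 0≤e) ⟩
        sum (λ j → y j * y j + e * (1# + x j * x j))
          ≈⟨ trans (sum-+ (λ j → y j * y j) (λ j → e * (1# + x j * x j))) (+-congˡ (trans (sum-* e (λ j → 1# + x j * x j))
               (*-congˡ (trans (sum-+ (λ _ → 1#) (λ j → x j * x j)) (+-congʳ (trans (sum-const d 1#) (*-identityʳ N))))))) ⟩
        norm² y + e * (N + norm² x)
          ≤⟨ +-mono-≤ (proj₂ y∈) ≤-refl ⟩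
        m + δ * δ + e * (N + norm² x)
          ≤⟨ ≤-by _ (*-nonNeg (<⇒≤ 0<δ) (≤⇒0≤- δ≤1))
               (solve 3 (λ m δ S → m :+ δ :* (con (+ 1) :+ con (+ 2) :* S) := m :+ δ :* δ :+ (δ :+ δ) :* S :+ δ :* (con (+ 1) :- δ))
                 refl m δ (N + norm² x)) ⟩
        m + δ * M ∎
        where
        open ≤-Reasoning
        e = δ + δ
        0≤e = <⇒≤ (+-pos 0<δ (<⇒≤ 0<δ))

      norm²≤m : norm² x ≤ m
      norm²≤m = ≮⇒≥ λ m<x →
        let g = norm² x - m
            0<g = <⇒0<- m<x
            -- The choice δ = g / (M + g) gives δ ≤ 1 and g - δ M = δ g > 0, which contradicts
            -- `norm²≤m+`.
            Q = M + g
            0≤M = +-nonNeg 0≤1 (*-nonNeg (<⇒≤ 0<2) 0≤N+x²)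
            0<Q = <-≤-trans 0<g (≤-by M 0≤M (+-comm M g))
            δ = Q ⁻¹ * g
            Qδ≈g = *-÷ (>⇒≉ 0<Q) g
            0<δ = *-pos (⁻¹-pos 0<Q) 0<g
            δ≤1 = *-cancelˡ-≤ 0<Q (≤-by M 0≤M (trans (*-identityʳ Q) (trans (+-comm M g) (+-congʳ (sym Qδ≈g)))))
        in <⇒≱ (*-pos 0<δ 0<g) (≤-by _ (≤⇒0≤- (norm²≤m+ 0<δ δ≤1))
             (trans (trans (sym (-‿inverseʳ g)) (+-congʳ (sym Qδ≈g)))
               (solve 5 (λ M g δ m s → (M :+ g) :* δ :- (s :- m) := δ :* g :+ (m :+ δ :* M :- s)) refl M g δ m (norm² x))))

    nearest-point : ∃[ x ] (x ∈ C × Minimal C x)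
    nearest-point = x , x∈C , λ y∈C → ≤-trans norm²≤m (m≤ y∈C)

    -- Both points lie in `Near 0#`, which has diameter zero by `near-dist²`.
    minimal-unique : ∀ {x y} → x ∈ C → Minimal C x → y ∈ C → Minimal C y → ∀ j → x j ≈ y j
    minimal-unique {x} {y} x∈C x-min y∈C y-min j = begin
      x j                ≈⟨ solve 2 (λ x y → x := y :+ (x :- y)) refl (x j) (y j) ⟩
      y j + (x j - y j)  ≈⟨ +-congˡ (sq≈0⇒≈0 (sum≈0⇒≈0 (λ j → sq-nonNeg (x j - y j)) dist≈0 j)) ⟩
      y j + 0#           ≈⟨ +-identityʳ (y j) ⟩
      y j                ∎
      where
      open ≈-Reasoning

      nearest : ∀ {z} → z ∈ C → Minimal C z → z ∈ Near 0#
      nearest z∈C z-min = z∈C , ≤-respʳ-≈ (solve 1 (λ m → m := m :+ con (+ 0) :* con (+ 0)) refl m)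
                                  (proj₁ (proj₂ infimum) z-min)

      dist≈0 : norm² (λ j → x j - y j) ≈ 0#
      dist≈0 = ≤-antisym
        (≤-respʳ-≈ (solve 0 ((con (+ 0) :+ con (+ 0)) :* (con (+ 0) :+ con (+ 0)) := con (+ 0)) refl)
          (near-dist² (nearest x∈C x-min) (nearest y∈C y-min)))
        (sum-nonNeg λ j → sq-nonNeg (x j - y j))

-- Finite subsets, pigeonhole and binomial coefficients.

module SubsetCounting where

  open import Data.Fin.Properties using (any?)
  open import Data.Fin.Subset
  open import Data.Fin.Subset.Properties
  open import Data.List.Base using (_++_; map; filter)
  open import Data.List.Membership.Propositional using () renaming (_∈_ to _∈ᴸ_)
  open import Data.List.Membership.Propositional.Properties using (∈-map⁺; ∈-++⁺ˡ; ∈-++⁺ʳ)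
  open import Data.List.Properties using (length-++; length-map)
  open import Data.List.Relation.Unary.AllPairs using ([]; _∷_)
  import Data.List.Relation.Unary.All.Properties as All
  open import Data.List.Relation.Unary.Any using (here; there)
  import Data.List.Relation.Unary.Unique.Propositional.Properties as Unique
  open import Data.Nat.Base using (_+_; _*_; _≤_; _<_; z≤n; s≤s)
  open import Data.Nat.Combinatorics using (_C_; nC1≡n; nCk+nC[k+1]≡[n+1]C[k+1])
  open import Data.Nat.Properties
  open import Data.Nat.Solver using (module +-*-Solver)
  open import Data.Vec.Base using ([]; _∷_; here; there)
  open import Relation.Binary.PropositionalEquality
  open import Relation.Nullary.Decidable using (¬?; _×-dec_; Dec)
  open import Relation.Unary using (Decidable)

  open +-*-Solver using (solve; con; _:=_; _:+_; _:*_)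

  private variable
    n : ℕ
    p q : Subset n

  ∣p∪q∣≤∣p∣+∣q∣ : (p q : Subset n) → ∣ p ∪ q ∣ ≤ ∣ p ∣ + ∣ q ∣
  ∣p∪q∣≤∣p∣+∣q∣ []            []            = z≤n
  ∣p∪q∣≤∣p∣+∣q∣ (outside ∷ p) (outside ∷ q) = ∣p∪q∣≤∣p∣+∣q∣ p q
  ∣p∪q∣≤∣p∣+∣q∣ (outside ∷ p) (inside  ∷ q) =
    subst (suc ∣ p ∪ q ∣ ≤_) (sym (+-suc ∣ p ∣ ∣ q ∣)) (s≤s (∣p∪q∣≤∣p∣+∣q∣ p q))
  ∣p∪q∣≤∣p∣+∣q∣ (inside  ∷ p) (outside ∷ q) = s≤s (∣p∪q∣≤∣p∣+∣q∣ p q)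
  ∣p∪q∣≤∣p∣+∣q∣ (inside  ∷ p) (inside  ∷ q) =
    s≤s (≤-trans (∣p∪q∣≤∣p∣+∣q∣ p q) (+-monoʳ-≤ ∣ p ∣ (n≤1+n ∣ q ∣)))

  image : ∀ {s} (e : Fin s → Fin n) → ∃[ p ] (∣ p ∣ ≤ s × (∀ j → e j ∈ p))
  image {n} {zero}  e = ⊥ , ≤-reflexive (∣⊥∣≡0 n) , λ ()
  image {n} {suc s} e =
    let p , ∣p∣≤s , e∈p = image (e ∘ suc) in
    ⁅ e zero ⁆ ∪ p ,
    ≤-trans (∣p∪q∣≤∣p∣+∣q∣ ⁅ e zero ⁆ p) (+-mono-≤ (≤-reflexive (∣⁅x⁆∣≡1 (e zero))) ∣p∣≤s) ,
    λ { zero    → p⊆p∪q p (x∈⁅x⁆ (e zero))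
      ; (suc j) → q⊆p∪q ⁅ e zero ⁆ p (e∈p j) }

  interpolate : ∀ {m} → p ⊆ q → ∣ p ∣ ≤ m → m ≤ ∣ q ∣ → ∃[ r ] (p ⊆ r × r ⊆ q × ∣ r ∣ ≡ m)
  interpolate {p = []} {[]} p⊆q z≤n z≤n = [] , (λ ()) , (λ ()) , refl
  interpolate {p = inside ∷ p} {outside ∷ q} p⊆q _ _ with () ← p⊆q here
  interpolate {p = inside ∷ p} {inside ∷ q} p⊆q (s≤s ∣p∣≤m) (s≤s m≤∣q∣) =
    let r , p⊆r , r⊆q , ∣r∣≡m = interpolate (drop-∷-⊆ p⊆q) ∣p∣≤m m≤∣q∣
    in inside ∷ r , s⊆s p⊆r , s⊆s r⊆q , cong suc ∣r∣≡m
  interpolate {p = outside ∷ p} {outside ∷ q} p⊆q ∣p∣≤m m≤∣q∣ =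
    let r , p⊆r , r⊆q , ∣r∣≡m = interpolate (drop-∷-⊆ p⊆q) ∣p∣≤m m≤∣q∣
    in outside ∷ r , s⊆s p⊆r , s⊆s r⊆q , ∣r∣≡m
  interpolate {p = outside ∷ p} {inside ∷ q} {m} p⊆q ∣p∣≤m m≤1+∣q∣ with m ≤? ∣ q ∣
  ... | yes m≤∣q∣ =
    let r , p⊆r , r⊆q , ∣r∣≡m = interpolate (drop-∷-⊆ p⊆q) ∣p∣≤m m≤∣q∣
    in outside ∷ r , s⊆s p⊆r , out⊆ r⊆q , ∣r∣≡m
  ... | no m≰∣q∣ = inside ∷ q , p⊆q , ⊆-refl , ≤-antisym (≰⇒> m≰∣q∣) m≤1+∣q∣

  subsetsOfSize : (n m : ℕ) → List (Subset n)
  subsetsOfSize zero    zero    = [] ∷ []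
  subsetsOfSize zero    (suc m) = []
  subsetsOfSize (suc n) zero    = map (outside ∷_) (subsetsOfSize n zero)
  subsetsOfSize (suc n) (suc m) = map (inside ∷_) (subsetsOfSize n m) ++ map (outside ∷_) (subsetsOfSize n (suc m))

  length-subsetsOfSize : ∀ n m → length (subsetsOfSize n m) ≡ n C m
  length-subsetsOfSize zero    zero    = refl
  length-subsetsOfSize zero    (suc m) = refl
  length-subsetsOfSize (suc n) zero    = trans (length-map _ (subsetsOfSize n zero)) (length-subsetsOfSize n zero)
  length-subsetsOfSize (suc n) (suc m) = begin
    length (map (inside ∷_) (subsetsOfSize n m) ++ map (outside ∷_) (subsetsOfSize n (suc m)))
      ≡⟨ length-++ (map (inside ∷_) (subsetsOfSize n m)) ⟩
    length (map (inside ∷_) (subsetsOfSize n m)) + length (map (outside ∷_) (subsetsOfSize n (suc m)))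
      ≡⟨ cong₂ _+_ (length-map _ (subsetsOfSize n m)) (length-map _ (subsetsOfSize n (suc m))) ⟩
    length (subsetsOfSize n m) + length (subsetsOfSize n (suc m))
      ≡⟨ cong₂ _+_ (length-subsetsOfSize n m) (length-subsetsOfSize n (suc m)) ⟩
    n C m + n C suc m   ≡⟨ nCk+nC[k+1]≡[n+1]C[k+1] n m ⟩
    suc n C suc m       ∎
    where open ≡-Reasoning

  ∈-subsetsOfSize : ∀ {m} → ∣ p ∣ ≡ m → p ∈ᴸ subsetsOfSize n m
  ∈-subsetsOfSize {p = []}          refl = here refl
  ∈-subsetsOfSize {p = inside  ∷ p} refl = ∈-++⁺ˡ (∈-map⁺ (inside ∷_) (∈-subsetsOfSize refl))
  ∈-subsetsOfSize {p = outside ∷ p} {m = zero}  ∣p∣≡m = ∈-map⁺ (outside ∷_) (∈-subsetsOfSize ∣p∣≡m)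
  ∈-subsetsOfSize {n = suc n} {p = outside ∷ p} {m = suc m} ∣p∣≡m =
    ∈-++⁺ʳ (map (inside ∷_) (subsetsOfSize n m)) (∈-map⁺ (outside ∷_) (∈-subsetsOfSize ∣p∣≡m))

  length-filter-∁ : {A : Set} {P : A → Set} (P? : Decidable P) (xs : List A) →
    length xs ≡ length (filter P? xs) + length (filter (¬? ∘ P?) xs)
  length-filter-∁ P? []       = refl
  length-filter-∁ P? (x ∷ xs) with P? x
  ... | yes _ = cong suc (length-filter-∁ P? xs)
  ... | no  _ = trans (cong suc (length-filter-∁ P? xs)) (sym (+-suc _ _))

  -- Each `b` in `ys` takes those elements that no earlier one has taken; the largest batch is at
  -- least the average, stated as a product to avoid division. `b₀` is the answer when `ys` is
  -- empty.
  pigeonhole : {A B : Set} {R : B → A → Set} → (∀ b → Decidable (R b)) →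
    B → (ys : List B) (xs : List A) → Unique xs → All (λ x → ∃[ b ] (b ∈ᴸ ys × R b x)) xs →
    ∃[ b ] ∃[ zs ] (Unique zs × All (R b) zs × length xs ≤ length ys * length zs)
  pigeonhole R? b₀ [] []       _ _                    = b₀ , [] , [] , [] , z≤n
  pigeonhole R? b₀ [] (x ∷ xs) _ ((_ , () , _) ∷ _)
  pigeonhole {R = R} R? b₀ (y ∷ ys) xs uniq covered
    with b , zs , zs-uniq , zs-R , rest≤ ← pigeonhole R? b₀ ys (filter (¬? ∘ R? y) xs) (Unique.filter⁺ (¬? ∘ R? y) uniq)
           (All.zipWith (λ { (¬Ryx , b , here refl , Rbx)   → contradiction Rbx ¬Ryx
                           ; (¬Ryx , b , there b∈ys , Rbx) → b , b∈ys , Rbx })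
             (All.all-filter (¬? ∘ R? y) xs , All.filter⁺ (¬? ∘ R? y) covered))
    with ≤-total (length zs) (length (filter (R? y) xs))
  ... | inj₁ zs≤ = y , filter (R? y) xs , Unique.filter⁺ (R? y) uniq , All.all-filter (R? y) xs , (begin
    length xs   ≡⟨ length-filter-∁ (R? y) xs ⟩
    length (filter (R? y) xs) + length (filter (¬? ∘ R? y) xs)  ≤⟨ +-monoʳ-≤ _ (≤-trans rest≤ (*-monoʳ-≤ (length ys) zs≤)) ⟩
    length (filter (R? y) xs) + length ys * length (filter (R? y) xs) ∎)
    where open ≤-Reasoning
  ... | inj₂ ≤zs = b , zs , zs-uniq , zs-R , (begin
    length xs   ≡⟨ length-filter-∁ (R? y) xs ⟩
    length (filter (R? y) xs) + length (filter (¬? ∘ R? y) xs)  ≤⟨ +-mono-≤ ≤zs rest≤ ⟩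
    length zs + length ys * length zs ∎)
    where open ≤-Reasoning

  ⊆∧∣q∣≤∣p∣⇒q⊆p : p ⊆ q → ∣ q ∣ ≤ ∣ p ∣ → q ⊆ p
  ⊆∧∣q∣≤∣p∣⇒q⊆p {p = p} p⊆q ∣q∣≤∣p∣ {x} x∈q = decidable-stable (x ∈? p) λ x∉p →
    <⇒≱ (p⊂q⇒∣p∣<∣q∣ (p⊆q , x , x∈q , x∉p)) ∣q∣≤∣p∣

  ∣p∣<∣q∣⇒∃∈∖ : ∣ p ∣ < ∣ q ∣ → ∃[ x ] (x ∈ q × x ∉ p)
  ∣p∣<∣q∣⇒∃∈∖ {p = p} {q} ∣p∣<∣q∣ with any? (λ x → x ∈? q ×-dec ¬? (x ∈? p))
  ... | yes witness = witness
  ... | no  ∄       = contradiction (p⊆q⇒∣p∣≤∣q∣ q⊆p) (<⇒≱ ∣p∣<∣q∣)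
    where
    q⊆p : q ⊆ p
    q⊆p {x} x∈q = decidable-stable (x ∈? p) λ x∉p → ∄ (x , x∈q , x∉p)

  -- Distinct covers of s each contribute their own element of g outside s.
  sunflower : ∀ {s g : Subset n} → s ⊆ g → (zs : List (Subset n)) → Unique zs →
    All (λ t → s ⊆ t × t ⊆ g × ∣ t ∣ ≡ suc ∣ s ∣) zs → ∣ s ∣ + length zs ≤ ∣ g ∣
  sunflower {s = s} s⊆g [] _ _ = subst (_≤ _) (sym (+-identityʳ ∣ s ∣)) (p⊆q⇒∣p∣≤∣q∣ s⊆g)
  sunflower {s = s} {g} s⊆g (t ∷ zs) (t∉zs ∷ uniq) ((s⊆t , t⊆g , ∣t∣≡) ∷ covers)
    with i , i∈t , i∉s ← ∣p∣<∣q∣⇒∃∈∖ (≤-reflexive (sym ∣t∣≡)) = begin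
    ∣ s ∣ + suc (length zs)   ≡⟨ +-suc ∣ s ∣ (length zs) ⟩
    -- A cover of `s` that contains `i` is s ∪ {i}, that is, `t`. So the other covers avoid `i` and
    -- lie in `g - i`.
    suc (∣ s ∣ + length zs)   ≤⟨ s≤s (sunflower (avoid s⊆g i∉s) zs uniq
                                   (All.zipWith remaining (t∉zs , covers))) ⟩
    suc ∣ g - i ∣             ≤⟨ x∈p⇒∣p-x∣<∣p∣ (t⊆g i∈t) ⟩
    ∣ g ∣                     ∎
    where
    open ≤-Reasoning

    avoid : ∀ {p} → p ⊆ g → i ∉ p → p ⊆ g - i
    avoid p⊆g i∉p x∈p = x∈p∧x≢y⇒x∈p-y (p⊆g x∈p) λ { refl → i∉p x∈p }

    union⊆ : ∀ {t′} → s ⊆ t′ → i ∈ t′ → s ∪ ⁅ i ⁆ ⊆ t′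
    union⊆ s⊆t′ i∈t′ x∈ with x∈p∪q⁻ s ⁅ i ⁆ x∈
    ... | inj₁ x∈s = s⊆t′ x∈s
    ... | inj₂ x∈i with refl ← x∈⁅y⁆⇒x≡y i x∈i = i∈t′

    ⊆union : ∀ {t′} → s ⊆ t′ → ∣ t′ ∣ ≡ suc ∣ s ∣ → i ∈ t′ → t′ ⊆ s ∪ ⁅ i ⁆
    ⊆union s⊆t′ ∣t′∣≡ i∈t′ = ⊆∧∣q∣≤∣p∣⇒q⊆p (union⊆ s⊆t′ i∈t′) (subst (_≤ ∣ s ∪ ⁅ i ⁆ ∣) (sym ∣t′∣≡)
      (p⊂q⇒∣p∣<∣q∣ (p⊆p∪q ⁅ i ⁆ , i , q⊆p∪q s ⁅ i ⁆ (x∈⁅x⁆ i) , i∉s)))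

    same : ∀ {t′} → s ⊆ t′ → ∣ t′ ∣ ≡ suc ∣ s ∣ → i ∈ t′ → t ≡ t′
    same s⊆t′ ∣t′∣≡ i∈t′ = ⊆-antisym (union⊆ s⊆t′ i∈t′ ∘ ⊆union s⊆t ∣t∣≡ i∈t) (union⊆ s⊆t i∈t ∘ ⊆union s⊆t′ ∣t′∣≡ i∈t′)

    remaining : ∀ {t′} → t ≢ t′ × s ⊆ t′ × t′ ⊆ g × ∣ t′ ∣ ≡ suc ∣ s ∣ → s ⊆ t′ × t′ ⊆ g - i × ∣ t′ ∣ ≡ suc ∣ s ∣
    remaining (t≢t′ , s⊆t′ , t′⊆g , ∣t′∣≡) = s⊆t′ , avoid t′⊆g (λ i∈t′ → t≢t′ (same s⊆t′ ∣t′∣≡ i∈t′)) , ∣t′∣≡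

  comprehension : {P : Fin n → Set} → (∀ i → Dec (P i)) → ∃[ p ] (∀ i → (i ∈ p → P i) × (P i → i ∈ p))
  comprehension {zero}  P? = [] , λ ()
  comprehension {suc n} P? with P? zero | comprehension (P? ∘ suc)
  ... | yes P₀ | p , p≃P = inside ∷ p , λ where
    zero    → (λ _ → P₀) , λ _ → here
    (suc i) → (λ { (there i∈p) → proj₁ (p≃P i) i∈p }) , λ Pᵢ → there (proj₂ (p≃P i) Pᵢ)
  ... | no ¬P₀ | p , p≃P = outside ∷ p , λ where
    zero    → (λ ()) , λ P₀ → contradiction P₀ ¬P₀
    (suc i) → (λ { (there i∈p) → proj₁ (p≃P i) i∈p }) , λ Pᵢ → there (proj₂ (p≃P i) Pᵢ)

  -- (m + 1) C(n, m+1) = (n - m) C(n, m), without the subtraction.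
  nC[1+m]-absorption : ∀ n m → suc m * (n C suc m) + m * (n C m) ≡ n * (n C m)
  nC[1+m]-absorption zero    zero    = refl
  nC[1+m]-absorption zero    (suc m) = cong₂ _+_ (*-zeroʳ m) (*-zeroʳ m)
  nC[1+m]-absorption (suc n) zero    = begin
    suc n C 1 + 0 + 0   ≡⟨ trans (+-identityʳ _) (+-identityʳ _) ⟩
    suc n C 1           ≡⟨ nC1≡n (suc n) ⟩
    suc n               ≡⟨ *-identityʳ (suc n) ⟨
    suc n * 1           ∎
    where open ≡-Reasoning
  nC[1+m]-absorption (suc n) (suc m) = begin
    (2 + m) * (suc n C (2 + m)) + suc m * (suc n C suc m)
      ≡⟨ cong₂ (λ x y → (2 + m) * x + suc m * y) (nCk+nC[k+1]≡[n+1]C[k+1] n (suc m)) (nCk+nC[k+1]≡[n+1]C[k+1] n m) ⟨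
    (2 + m) * (b + c) + suc m * (a + b)
      ≡⟨ solve 4 (λ m a b c → (con 2 :+ m) :* (b :+ c) :+ (con 1 :+ m) :* (a :+ b)
           := ((con 2 :+ m) :* c :+ (con 1 :+ m) :* b) :+ b :+ (((con 1 :+ m) :* b :+ m :* a) :+ a)) refl m a b c ⟩
    ((2 + m) * c + suc m * b) + b + ((suc m * b + m * a) + a)
      ≡⟨ cong₂ (λ x y → x + b + (y + a)) (nC[1+m]-absorption n (suc m)) (nC[1+m]-absorption n m) ⟩
    n * b + b + (n * a + a)
      ≡⟨ solve 3 (λ n a b → n :* b :+ b :+ (n :* a :+ a) := (con 1 :+ n) :* (a :+ b)) refl n a b ⟩
    suc n * (a + b)   ≡⟨ cong (suc n *_) (nCk+nC[k+1]≡[n+1]C[k+1] n m) ⟩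
    suc n * (suc n C suc m) ∎
    where
    open ≡-Reasoning
    a = n C m
    b = n C suc m
    c = n C (2 + m)

  nCm>0 : ∀ {n m} → m ≤ n → 0 < n C m
  nCm>0 {n}     {zero}  _         = s≤s z≤n
  nCm>0 {suc n} {suc m} (s≤s m≤n) =
    subst (0 <_) (nCk+nC[k+1]≡[n+1]C[k+1] n m) (≤-trans (nCm>0 m≤n) (m≤m+n _ _))

-- Few sets determine the nearest point and the lineality space.

module FlatBasis (em : ExcludedMiddle 0ℓ) (ℝ : RealField) where

  open import Data.Fin.Properties using (punchIn-punchOut)
  import Data.Fin.Subset.Properties as Subset
  open import Data.List.Base using (allFin)
  open import Data.List.Membership.Propositional.Properties using (∈-allFin)
  open import Relation.Unary using (_∈_; _⊆_)

  open SubsetCounting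
  open OrderedField em ℝ
  open LinearAlgebra em ℝ
  open ConvexGeometry em ℝ
  open Radon em ℝ
  open NearestPoint em ℝ
  open RealField ℝ hiding (zero)
  open Euclidean ℝ

  module _ {d} {I : Set} {A : I → Pred (Point d) 0ℓ} (A-cc : ∀ i → ClosedConvex (A i))
           {x : Point d} (x∈⋂A : x ∈ Meet A) where

    -- The vectors witness that the lineality space has codimension at least s.
    record Basis (s : ℕ) : Set where
      field
        index       : Fin s → I
        minimal     : Minimal (Meet (A ∘ index)) x
        vectors     : Vector (Point d) s
        independent : IndependentModulo (Lineality x (Meet (A ∘ index))) vectors

    reduce : ∀ {s} (e : Fin s → I) → Minimal (Meet (A ∘ e)) x → ∃[ s ] Basis s
    reduce {zero} e x-min = zero , record
      { index = e ; minimal = x-min ; vectors = λ () ; independent = λ t _ () }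
    reduce {suc s} e x-min with em {∃[ i ] Minimal (Meet (A ∘ e ∘ punchIn i)) x}
    ... | yes (i , still-min) = reduce (e ∘ punchIn i) still-min
    ... | no  essential       = suc s , record
      { index       = e
      ; minimal     = x-min
      ; vectors     = λ i j → proj₁ (closer i) j - x j
      ; independent = offsets-independent (A-cc ∘ e) (x∈⋂A ∘ e) x-min
          (λ i j i≢j → ≡.subst (λ h → proj₁ (closer i) ∈ A (e h)) (punchIn-punchOut i≢j) (proj₁ (proj₂ (closer i)) _))
          (λ i → proj₂ (proj₂ (closer i)))
      }
      where
      closer : ∀ i → ∃[ y ] (y ∈ Meet (A ∘ e ∘ punchIn i) × norm² y < norm² x)
      closer i = by-contradiction λ ∄y → essential (i , λ {y} y∈ → ≮⇒≥ λ y<x → ∄y (y , y∈ , y<x))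

    -- A set is added only if it cuts the lineality space, and then brings a lost direction as its
    -- vector, so indices and vectors grow together. The meet only shrinks, which preserves
    -- minimality of `x` and the inclusions already reached.
    extend : ∀ (is : List I) {s} (b : Basis s) → ∃[ s′ ] ∃[ b′ ]
      (Meet (A ∘ Basis.index {s′} b′) ⊆ Meet (A ∘ Basis.index b) ×
       All (λ i → Lineality x (Meet (A ∘ Basis.index b′)) ⊆ Lineality x (A i)) is)
    extend []       {s} b = s , b , (λ x∈ → x∈) , []
    extend (i ∷ is) {s} b with em {Lineality x (Meet (A ∘ Basis.index b)) ⊆ Lineality x (A i)}
    ... | yes L⊆Lᵢ =
      let s′ , b′ , ⋂⊆ , L⊆ = extend is b
      in s′ , b′ , ⋂⊆ , (λ v∈L t → L⊆Lᵢ (λ t → ⋂⊆ (v∈L t)) t) ∷ L⊆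
    ... | no L⊈Lᵢ =
      let s′ , b′ , ⋂⊆ , L⊆ = extend is b⁺
      in s′ , b′ , (λ y∈ → ⋂⊆ y∈ ∘ suc) , (λ v∈L t → ⋂⊆ (v∈L t) zero) ∷ L⊆
      where
      open Basis b
      L = Lineality x (Meet (A ∘ index))

      fresh : ∃[ u ] (u ∈ L × ¬ u ∈ Lineality x (A i))
      fresh = by-contradiction λ ∄u → L⊈Lᵢ λ {u} u∈L → by-contradiction λ u∉Lᵢ → ∄u (u , u∈L , u∉Lᵢ)

      lineality-isSubspace : ∀ {s} (e : Fin s → I) → IsSubspace (Lineality x (Meet (A ∘ e)))
      lineality-isSubspace e = ClosedConvex.lineality-isSubspace (Meet-closedConvex (A-cc ∘ e))

      b⁺ : Basis (suc s)
      b⁺ = record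
        { index       = i Vector.∷ index
        ; minimal     = λ y∈ → minimal (y∈ ∘ suc)
        ; vectors     = proj₁ fresh Vector.∷ vectors
        ; independent = independent-∷ (lineality-isSubspace index) (lineality-isSubspace (i Vector.∷ index))
            (λ v∈L t → v∈L t ∘ suc) independent (proj₁ (proj₂ fresh)) (λ u∈L → proj₂ (proj₂ fresh) λ t → u∈L t zero)
        }

  -- A k-flat moved to the nearest point. Its directions lie in the lineality space but need not
  -- span it.
  record MinimalFlat {d} (k : ℕ) (C : Pred (Point d) 0ℓ) : Set where
    field
      point       : Point d
      point∈C     : point ∈ C
      minimal     : Minimal C point
      direction   : Vector (Point d) k
      independent : LinearlyIndependent direction
      span⊆       : ∀ t → combination t direction ∈ Lineality point C

  minimalFlat : ∀ {d k} {C : Pred (Point d) 0ℓ} → ClosedConvex C → ContainsFlat k C → MinimalFlat k C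
  minimalFlat {k = k} C-cc (E , E⊆C) =
    let open Flat E
        open ClosedConvex C-cc
        x , x∈C , x-min = nearest-point C-cc (E⊆C ((λ _ → 0#) , λ j → sym (trans (+-congˡ (sum-0 λ i → zeroˡ (direction i j))) (+-identityʳ _))))
        base+span⊆C = λ t r → E⊆C ((λ i → r * t i) , λ j → +-congˡ (sym (combination-* r t direction j)))
    in record
      { point = x ; point∈C = x∈C ; minimal = x-min ; direction = direction ; independent = independent
      ; span⊆ = λ t r → translate (IsSubspace.*-closed lineality-isSubspace r (base+span⊆C t)) x∈C
      }

  module _ {d n} {A : Fin n → Pred (Point d) 0ℓ} (A-cc : ∀ i → ClosedConvex (A i)) where

    -- The k directions lie in the lineality space of the subfamily as well, so s vectors
    -- independent modulo that space leave s + k ≤ d.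
    small-subfamily : ∀ {k} (E : MinimalFlat k (Meet A)) → let x = MinimalFlat.point E in
      ∃[ s ] Σ[ e ∈ (Fin s → Fin n) ] (s ℕ.+ k ℕ.≤ d × Minimal (Meet (A ∘ e)) x ×
                                       Lineality x (Meet (A ∘ e)) ⊆ Lineality x (Meet A))
    small-subfamily E =
      let open MinimalFlat E
          _ , b = reduce A-cc point∈C (λ i → i) minimal
          s , b′ , _ , L⊆ = extend A-cc point∈C (allFin n) b
          open Basis b′ renaming (independent to vectors-independent; minimal to index-minimal)
          L-sub = ClosedConvex.lineality-isSubspace (Meet-closedConvex (A-cc ∘ index))
      in s , index ,
         independent-modulo-span (IsSubspace.respects L-sub) vectors-independent independent (λ t r i → span⊆ t r (index i)) ,
         index-minimal ,
         λ v∈L t i → All.lookup L⊆ (∈-allFin i) v∈L t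

  module _ {d n} {F : Fin n → Pred (Point d) 0ℓ} (F-cc : ∀ i → ClosedConvex (F i)) where

    private
      -- Sets outside `T` become the whole space, so that subfamilies keep the index type `Fin n`.
      Restricted : Subset n → Fin n → Pred (Point d) 0ℓ
      Restricted T i y = i Subset.∈ T → y ∈ F i

      restricted-closedConvex : ∀ T i → ClosedConvex (Restricted T i)
      restricted-closedConvex T i = record
        { closed = λ y y∉ → let i∈T = by-contradiction λ i∉T → y∉ λ i∈T → contradiction i∈T i∉T
                                ε , 0<ε , ball = ClosedConvex.closed (F-cc i) y λ y∈F → y∉ λ _ → y∈F
                            in ε , 0<ε , λ z near z∈ → ball z near (z∈ i∈T)
        ; convex = λ y z y∈ z∈ t 0≤t t≤1 i∈T → ClosedConvex.convex (F-cc i) y z (y∈ i∈T) (z∈ i∈T) t 0≤t t≤1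
        }

      ⋂-closedConvex : ∀ T → ClosedConvex (⋂ F T)
      ⋂-closedConvex T = record
        { closed = λ y y∉ → let ε , 0<ε , ball = ClosedConvex.closed R-cc y (λ y∈ → y∉ λ {i} → y∈ i)
                            in ε , 0<ε , λ z near z∈ → ball z near λ i → z∈ {i}
        ; convex = λ y z y∈ z∈ t 0≤t t≤1 {i} → ClosedConvex.convex R-cc y z (λ i → y∈ {i}) (λ i → z∈ {i}) t 0≤t t≤1 i
        }
        where R-cc = Meet-closedConvex (restricted-closedConvex T)

    -- The nearest point and the lineality space of ⋂ F T can be read off ⋂ F S; the converse
    -- inclusion of lineality spaces comes from S ⊆ T.
    record Determines (k : ℕ) (S T : Subset n) : Set where
      field
        S⊆T        : S Subset.⊆ T
        flat       : MinimalFlat k (⋂ F T)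
      open MinimalFlat flat public
      field
        minimal-⋂S : Minimal (⋂ F S) point
        lineality⊆ : Lineality point (⋂ F S) ⊆ Lineality point (⋂ F T)

    determining-subset : ∀ {k T} → k ℕ.≤ d → ∣ T ∣ ≡ suc (d ∸ k) → ContainsFlat k (⋂ F T) →
      ∃[ S ] (∣ S ∣ ≡ d ∸ k × Determines k S T)
    determining-subset {k} {T} k≤d ∣T∣≡ flat⊆ =
      let E = minimalFlat (⋂-closedConvex T) flat⊆
          open MinimalFlat E
          s , e , s+k≤d , min , L⊆ = small-subfamily (restricted-closedConvex T) record
            { MinimalFlat E using (point; direction; independent)
            ; point∈C = λ i → point∈C {i} ; minimal = λ y∈ → minimal λ {i} → y∈ i ; span⊆ = λ t r i → span⊆ t r {i} }
          S₀ , ∣S₀∣≤s , e∈S₀ = image e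
          -- Indices outside `T` impose no condition and are discarded; the rest is padded inside
          -- `T` to exactly d - k sets. Padding shrinks the meet, which keeps `x` nearest.
          S , S₀⊆S , S⊆T , ∣S∣≡ = interpolate (Subset.p∩q⊆q S₀ T)
            (ℕ.≤-trans (Subset.∣p∩q∣≤∣p∣ S₀ T) (ℕ.≤-trans ∣S₀∣≤s (ℕ.m+n≤o⇒m≤o∸n s s+k≤d)))
            (ℕ.≤-trans (ℕ.n≤1+n _) (ℕ.≤-reflexive (≡.sym ∣T∣≡)))
          ⋂S⊆ : ⋂ F S ⊆ Meet (Restricted T ∘ e)
          ⋂S⊆ = λ y∈ j e∈T → y∈ (S₀⊆S (Subset.x∈p∩q⁺ (e∈S₀ j , e∈T)))
      in S , ∣S∣≡ , record
        { S⊆T = S⊆T ; flat = E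
        ; minimal-⋂S = λ y∈ → min (⋂S⊆ y∈)
        ; lineality⊆ = λ v∈L t {i} → L⊆ (λ t → ⋂S⊆ (v∈L t)) t i
        }

    -- Both points are nearest in ⋂ F S, hence equal. The directions of `D` are lineality directions
    -- of ⋂ F S, because S ⊆ T, and so of ⋂ F T′ by the inclusion in `D′`.
    determined-flat⊆ : ∀ {k S T T′} (D : Determines k S T) → Determines k S T′ →
      let open Determines D in ∀ t → (λ j → point j + combination t direction j) ∈ ⋂ F T′
    determined-flat⊆ {S = S} {T′ = T′} D D′ t = ClosedConvex.respects (⋂-closedConvex T′)
      (λ j → +-cong (sym (x≈x′ j)) (*-identityˡ _))
      (D′.lineality⊆ (λ r → ClosedConvex.respects (⋂-closedConvex S) (λ j → +-congʳ (x≈x′ j))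
        λ i∈S → D.span⊆ t r (D.S⊆T i∈S)) 1#)
      where
      module D  = Determines D
      module D′ = Determines D′

      x≈x′ : ∀ j → D.point j ≈ D′.point j
      x≈x′ = minimal-unique (⋂-closedConvex S) {D.point} (λ i∈S → D.point∈C (D.S⊆T i∈S))
        (λ i∈S → D.point∈C (D.S⊆T i∈S)) D.minimal-⋂S (λ i∈S → D′.point∈C (D′.S⊆T i∈S)) D′.minimal-⋂S

-- Counting good families and the final bound.

module FractionalHelly (em : ExcludedMiddle 0ℓ) (ℝ : RealField) where

  open import Data.Integer.Base using (+_)
  open import Data.List.Membership.Propositional using () renaming (_∈_ to _∈ᴸ_)
  open import Data.Nat.Combinatorics using (_C_)
  open import Relation.Unary using (_∈_)

  open SubsetCounting
  open OrderedField em ℝ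
  open ConvexGeometry em ℝ
  open FlatBasis em ℝ
  open RealField ℝ
  open Euclidean ℝ


  -- The hypothesis makes N at least α (n - m) / (m + 1), and the summand m covers the missing α m /
  -- (m + 1) since α ≤ 1. Denominators are cleared by the positive factor (m + 1) C(n, m).
  α÷[1+m]*n≤ : ∀ {α} → 0# < α → α ≤ 1# → ∀ {m n N} → m ℕ.≤ n →
    α * fromℕ (n C suc m) ≤ fromℕ ((n C m) ℕ.* N) → α ÷ fromℕ (suc m) * fromℕ n ≤ fromℕ (m ℕ.+ N)
  α÷[1+m]*n≤ {α} 0<α α≤1 {m} {n} {N} m≤n many = *-cancelˡ-≤ (*-pos (fromℕ-pos m) 0<c₀) (begin
    M * c₀ * (α * M ⁻¹ * fromℕ n)
      ≈⟨ solve 5 (λ M c a i n → M :* c :* (a :* i :* n) := M :* (i :* (a :* (n :* c)))) refl M c₀ α (M ⁻¹) (fromℕ n) ⟩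
    M * (M ⁻¹ * (α * (fromℕ n * c₀)))        ≈⟨ *-÷ (>⇒≉ (fromℕ-pos m)) _ ⟩
    α * (fromℕ n * c₀)                       ≈⟨ *-congˡ absorption ⟩
    α * (M * c₁ + fromℕ m * c₀)
      ≈⟨ solve 4 (λ a M c d → a :* (M :* c :+ d) := M :* (a :* c) :+ d :* a) refl α M c₁ (fromℕ m * c₀) ⟩
    M * (α * c₁) + fromℕ m * c₀ * α
      ≤⟨ +-mono-≤ (*-monoˡ-≤ (<⇒≤ (fromℕ-pos m)) (≤-respʳ-≈ (fromℕ-* (n C m) N) many))
                  (*-monoˡ-≤ (*-nonNeg (fromℕ-nonNeg m) (<⇒≤ 0<c₀)) α≤1) ⟩
    M * (c₀ * fromℕ N) + fromℕ m * c₀ * 1#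
      ≤⟨ ≤-by (fromℕ m * fromℕ m * c₀) (*-nonNeg (*-nonNeg (fromℕ-nonNeg m) (fromℕ-nonNeg m)) (<⇒≤ 0<c₀))
           (solve 3 (λ m c N → let M = con (+ 1) :+ m in
              M :* c :* (m :+ N) := M :* (c :* N) :+ m :* c :* con (+ 1) :+ m :* m :* c) refl (fromℕ m) c₀ (fromℕ N)) ⟩
    M * c₀ * (fromℕ m + fromℕ N)             ≈⟨ *-congˡ (fromℕ-+ m N) ⟨
    M * c₀ * fromℕ (m ℕ.+ N)                 ∎)
    where
    open ≤-Reasoning
    M  = fromℕ (suc m)
    c₀ = fromℕ (n C m)
    c₁ = fromℕ (n C suc m)

    0<c₀ : 0# < c₀
    0<c₀ = <-≤-trans (fromℕ-pos 0) (fromℕ-mono-≤ (nCm>0 m≤n))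

    absorption : fromℕ n * c₀ ≈ M * c₁ + fromℕ m * c₀
    absorption = begin-equality
      fromℕ n * c₀                        ≈⟨ fromℕ-* n (n C m) ⟨
      fromℕ (n ℕ.* (n C m))               ≡⟨ ≡.cong fromℕ (nC[1+m]-absorption n m) ⟨
      fromℕ (suc m ℕ.* (n C suc m) ℕ.+ m ℕ.* (n C m))
        ≈⟨ fromℕ-+ (suc m ℕ.* (n C suc m)) (m ℕ.* (n C m)) ⟩
      fromℕ (suc m ℕ.* (n C suc m)) + fromℕ (m ℕ.* (n C m))
        ≈⟨ +-cong (fromℕ-* (suc m) (n C suc m)) (fromℕ-* m (n C m)) ⟩
      M * c₁ + fromℕ m * c₀               ∎

  module _ {k d n : ℕ} {F : Fin n → Pred (Point d) 0ℓ} (F-cc : ∀ i → ClosedConvex (F i)) where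

    Determined : Subset n → Pred (Subset n) 0ℓ
    Determined S T = ∣ S ∣ ≡ d ∸ k × ∣ T ∣ ≡ suc (d ∸ k) × Determines F-cc k S T

    -- The flat is that of the first family in `zs`, and `G` collects all sets containing it. Every
    -- family in `zs` lies in `G` by `determined-flat⊆`, so `sunflower` bounds the size of `G`.
    common-flat : ∀ {S} zs → Unique zs → All (Determined S) zs → zs ≢ [] →
      Σ[ G ∈ Subset n ] (d ∸ k ℕ.+ length zs ℕ.≤ ∣ G ∣ × ContainsFlat k (⋂ F G))
    common-flat [] _ _ zs≢[] = contradiction ≡.refl zs≢[]
    common-flat {S} zs@(_ ∷ _) uniq determined@((∣S∣≡ , _ , D) ∷ _) _ =
      G , ≡.subst (λ h → h ℕ.+ length zs ℕ.≤ ∣ G ∣) ∣S∣≡ (sunflower S⊆G zs uniq (All.map cover determined)) ,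
      record { base = point ; direction = direction ; independent = independent } ,
      λ { (t , p≈) {i} i∈G → ClosedConvex.respects (F-cc i) (λ j → sym (p≈ j)) (proj₁ (G≃ i) i∈G t) }
      where
      open Determines D

      Flat⊆ : Fin n → Set
      Flat⊆ i = ∀ t → (λ j → point j + combination t direction j) ∈ F i

      G  = proj₁ (comprehension {P = Flat⊆} (λ i → em))
      G≃ = proj₂ (comprehension {P = Flat⊆} (λ i → em))

      T⊆G : ∀ {T} → Determines F-cc k S T → T Subset.⊆ G
      T⊆G D′ {i} i∈T = proj₂ (G≃ i) λ t → determined-flat⊆ F-cc D D′ t i∈T

      S⊆G : S Subset.⊆ G
      S⊆G i∈S = T⊆G D (S⊆T i∈S)

      cover : ∀ {T} → Determined S T → S Subset.⊆ T × T Subset.⊆ G × ∣ T ∣ ≡ suc ∣ S ∣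
      cover (_ , ∣T∣≡ , D′) = Determines.S⊆T D′ , T⊆G D′ , ≡.trans ∣T∣≡ (≡.cong suc (≡.sym ∣S∣≡))

    determine : k ℕ.≤ d → ∀ {T} → ∣ T ∣ ≡ suc (d ∸ k) × ContainsFlat k (⋂ F T) →
                ∃[ S ] (S ∈ᴸ subsetsOfSize n (d ∸ k) × Determined S T)
    determine k≤d {T} (∣T∣≡ , flat⊆) = locate (determining-subset F-cc {k} {T} k≤d ∣T∣≡ flat⊆)
      where
      locate : ∃[ S ] (∣ S ∣ ≡ d ∸ k × Determines F-cc k S T) → ∃[ S ] (S ∈ᴸ subsetsOfSize n (d ∸ k) × Determined S T)
      locate (S , ∣S∣≡ , D) = S , ∈-subsetsOfSize ∣S∣≡ , ∣S∣≡ , ∣T∣≡ , D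

    fractional-helly : ∀ {α} → k ℕ.≤ d → 0# < α → α ≤ 1# → suc (d ∸ k) ℕ.≤ n →
      AtLeast (α * fromℕ (n C suc (d ∸ k))) (λ S → ∣ S ∣ ≡ suc (d ∸ k) × ContainsFlat k (⋂ F S)) →
      Σ[ G ∈ Subset n ] (α ÷ fromℕ (suc (d ∸ k)) * fromℕ n ≤ fromℕ ∣ G ∣ × ContainsFlat k (⋂ F G))
    fractional-helly {α} k≤d 0<α α≤1 m<n (xs , uniq , good , many) = conclude
      (pigeonhole {R = Determined} (λ S T → em) Subset.⊥ (subsetsOfSize n (d ∸ k)) xs uniq (All.map (determine k≤d) good))
      where
      -- Here n ≥ d - k + 1 matters: it makes C(n, d - k + 1) positive, so at least one family
      -- shares `S` and supplies a flat.
      nonempty : ∀ {zs : List (Subset n)} → α * fromℕ (n C suc (d ∸ k)) ≤ fromℕ ((n C (d ∸ k)) ℕ.* length zs) → zs ≢ []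
      nonempty many ≡.refl = <⇒≱ (*-pos 0<α (<-≤-trans (fromℕ-pos 0) (fromℕ-mono-≤ (nCm>0 m<n))))
        (≤-trans many (≤-reflexive (reflexive (≡.cong fromℕ (ℕ.*-zeroʳ (n C (d ∸ k)))))))

      conclude : ∃[ S ] ∃[ zs ] (Unique zs × All (Determined S) zs × length xs ℕ.≤ length (subsetsOfSize n (d ∸ k)) ℕ.* length zs) →
                 Σ[ G ∈ Subset n ] (α ÷ fromℕ (suc (d ∸ k)) * fromℕ n ≤ fromℕ ∣ G ∣ × ContainsFlat k (⋂ F G))
      conclude (S , zs , uniq , determined , ∣xs∣≤) =
        let G , large , flat⊆ = common-flat zs uniq determined (nonempty many′)
        in G , ≤-trans (α÷[1+m]*n≤ 0<α α≤1 (ℕ.<⇒≤ m<n) many′) (fromℕ-mono-≤ large) , flat⊆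
        where
        many′ : α * fromℕ (n C suc (d ∸ k)) ≤ fromℕ ((n C (d ∸ k)) ℕ.* length zs)
        many′ = ≤-trans many (fromℕ-mono-≤ (≡.subst (λ h → length xs ℕ.≤ h ℕ.* length zs) (length-subsetsOfSize n (d ∸ k)) ∣xs∣≤))

open import Data.Nat.Combinatorics using (_C_)

theorem5 :
  ExcludedMiddle 0ℓ → (ℝ : RealField) →
  let open RealField ℝ
      open Euclidean ℝ
  in
  (k d : ℕ) → k ℕ.≤ d →
  (α : Carrier) → 0# < α → α ≤ 1# →
  ∃[ β ] (0# < β × α ÷ fromℕ (suc (d ∸ k)) ≤ β ×
    ((n : ℕ) (F : Fin n → Pred (Point d) 0ℓ) →
     suc (d ∸ k) ℕ.≤ n →
     (∀ i → Closed (F i)) → (∀ i → Convex (F i)) →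
     AtLeast (α * fromℕ (n C suc (d ∸ k)))
       (λ (S : Subset n) → ∣ S ∣ ≡ suc (d ∸ k) × ContainsFlat k (⋂ F S)) →
     Σ[ G ∈ Subset n ] (β * fromℕ n ≤ fromℕ ∣ G ∣ × ContainsFlat k (⋂ F G))))
theorem5 em ℝ k d k≤d α 0<α α≤1 =
  α ÷ fromℕ (suc (d ∸ k)) , *-pos 0<α (⁻¹-pos (fromℕ-pos (d ∸ k))) , ≤-refl ,
  λ n F m<n closed convex → fractional-helly (λ i → record { closed = closed i ; convex = convex i }) k≤d 0<α α≤1 m<n
  where
  open RealField ℝ
  open OrderedField em ℝ
  open FractionalHelly em ℝ
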